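{- For each $k\ge1$, the classification strategy $\mathcal{SP}_k$ is asymptotically optimal, i.e., there is a constant $\varepsilon>0$ such that its average comparison count for classifying the $n-k$ non-pivot elements differs from that of the optimal strategy $\mathcal{O}_k$ by at most $O(n^{1-\varepsilon})$.
   Context: Input: a uniformly random permutation $(e_1,\dots,e_n)$ of $\{1,\dots,n\}$, $n>k$; pivots $p_1<\dots<p_k$ are $e_1,\dots,e_k$ sorted, $p_0=0,p_{k+1}=n+1$; $x$ belongs to group $A_h$ if $p_h<x<p_{h+1}$, and $a_h=p_{h+1}-p_h-1$. A comparison tree is a binary search tree with inner nodes labeled $p_1,\dots,p_k$ in inorder and leaves $A_0,\dots,A_k$ left to right; classifying an $A_h$-element with $\lambda$ costs $\mathrm{depth}_\lambda(A_h)$ comparisons; $\mathrm{cost}^\lambda(a'_0,\dots,a'_k)=\sum_i\mathrm{depth}_\lambda(A_i)a'_i$. A classification strategy classifies $e_{k+1},\dots,e_n$ one at a time, choosing the comparison tree for each element as a function of the pivots and outcomes so far; $a^v_h$ is the number of elements classified into $A_h$ before step $v$. Strategy $\mathcal{O}_k$ uses at step $v$ a comparison tree minimizing $\mathrm{cost}^\lambda(a_0-a^v_0,\dots,a_k-a^v_k)$. Strategy $\mathcal{SP}_k$: fix an arbitrary comparison tree $\lambda_0$; after the pivots are chosen, classify the first $n^{3/4}$ non-pivot elements using $\lambda_0$, and let $a'_0,\dots,a'_k$ be the numbers of them found in $A_0,\dots,A_k$; let $\lambda$ be a comparison tree minimizing $\mathrm{cost}^\lambda(a'_0,\dots,a'_k)$;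 classify all remaining elements using $\lambda$. -}

module Defs where

open import Data.Nat using (ℕ; zero; suc; _+_; _*_; _∸_; _^_; _≤_; _<_; _≤?_; _<?_; _≟_)
open import Data.Nat.Base using (_!; ∣_-_∣)
open import Data.Fin using (Fin; toℕ)
open import Data.Vec using (Vec; []; _∷_; tabulate)
open import Data.List using (List; []; _∷_; [_]; map; concatMap; length; filter; take; drop; upTo; applyUpTo)
open import Data.Nat.ListAction using (sum)
open import Relation.Nullary using (yes; no)

-- Comparison trees for k pivots: binary trees with k inner nodes.
-- Inner nodes are implicitly labelled p_1..p_k in inorder, leaves
-- A_0..A_k left to right (leaf indices 0..k as natural numbers).

data Tree : ℕ → Set where
  leaf : Tree 0
  node : ∀ {l r} → Tree l → Tree r → Tree (suc (l + r))

-- depth of leaf A_i (left subtree with l inner nodes holds leaves 0..l)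
depth : ∀ {k} → Tree k → ℕ → ℕ
depth leaf i = 0
depth (node {l} L R) i with i ≤? l
... | yes _ = suc (depth L i)
... | no _ = suc (depth R (i ∸ suc l))

-- reading / decrementing an entry of a count vector (0 / no-op out of range)
at : ∀ {m} → Vec ℕ m → ℕ → ℕ
at [] _ = 0
at (x ∷ xs) zero = x
at (x ∷ xs) (suc i) = at xs i

decAt : ∀ {m} → Vec ℕ m → ℕ → Vec ℕ m
decAt [] _ = []
decAt (x ∷ xs) zero = (x ∸ 1) ∷ xs
decAt (x ∷ xs) (suc i) = x ∷ decAt xs i

costT : ∀ {k} → Tree k → Vec ℕ (suc k) → ℕ
costT {k} t v = sum (map (λ i → depth t i * at v i) (upTo (suc k)))

Minimizing : ∀ {k} → (Vec ℕ (suc k) → Tree k) → Set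
Minimizing {k} sel = ∀ (v : Vec ℕ (suc k)) (t : Tree k) → costT (sel v) v ≤ costT t v

insertions : ℕ → List ℕ → List (List ℕ)
insertions x [] = [ x ∷ [] ]
insertions x (y ∷ ys) = (x ∷ y ∷ ys) ∷ map (y ∷_) (insertions x ys)

perms : ℕ → List (List ℕ)
perms zero = [ [] ]
perms (suc n) = concatMap (insertions (suc n)) (perms n)

-- group index h of x (p_h < x < p_{h+1}): number of pivots e_1..e_k below x
grp : ℕ → List ℕ → ℕ → ℕ
grp k e x = length (filter (_<? x) (take k e))

counts : (k : ℕ) → List ℕ → List ℕ → Vec ℕ (suc k)
counts k e xs = tabulate (λ (h : Fin (suc k)) → length (filter (λ x → grp k e x ≟ toℕ h) xs))

-- Strategy O_k: at each step use a tree minimizing cost on the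
-- remaining counts (a_0 - a^v_0, …, a_k - a^v_k).

goO : (k : ℕ) → List ℕ → (Vec ℕ (suc k) → Tree k) → Vec ℕ (suc k) → List ℕ → ℕ
goO k e sel rem [] = 0
goO k e sel rem (x ∷ xs) = depth (sel rem) (grp k e x) + goO k e sel (decAt rem (grp k e x)) xs

costO : (k : ℕ) → (Vec ℕ (suc k) → Tree k) → List ℕ → ℕ
costO k sel e = goO k e sel (counts k e (drop k e)) (drop k e)

-- ⌊n^{3/4}⌋ = #{m ∈ 1..n : m^4 ≤ n^3}
sampleSize : ℕ → ℕ
sampleSize n = length (filter (λ m → m ^ 4 ≤? n ^ 3) (applyUpTo suc n))

costSP : (k : ℕ) → Tree k → (Vec ℕ (suc k) → Tree k) → ℕ → List ℕ → ℕ
costSP k t0 sel n e =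
  sum (map (λ x → depth t0 (grp k e x)) samp)
  + sum (map (λ x → depth (sel (counts k e samp)) (grp k e x)) (drop s rest))
  where
  rest = drop k e
  s = sampleSize n
  samp = take s rest

-- total comparison counts over all n! inputs (average = total / n!)
totalO : (k : ℕ) → (Vec ℕ (suc k) → Tree k) → ℕ → ℕ
totalO k sel n = sum (map (costO k sel) (perms n))

totalSP : (k : ℕ) → Tree k → (Vec ℕ (suc k) → Tree k) → ℕ → ℕ
totalSP k t0 sel n = sum (map (costSP k t0 sel n) (perms n))

{-# OPTIONS --safe #-}

-- Condition on the pivots, let a be the group counts of the m = n − k remaining elements, and
-- compare both strategies with A, the cost of the best fixed tree for a.
-- O_k: a step costs at most the drop of the optimal cost of the remaining counts, so telescoping
-- gives O ≤ A. Conversely, with r elements left a step costs on average opt(rem) / r, and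
-- m · opt(rem) ≥ r · A − k Σ_h |m rem_h − r a_h|.
-- SP_k: with λ chosen from a sample c of size s, s · cost^λ(a) ≤ s · A + 2 k Σ_h |m c_h − s a_h|,
-- and always A ≤ SP + k s.
-- The deviations have hypergeometric second moment at most m² times the sample (or remainder) size,
-- so with q = ⌊n^{1/4}⌋ both strategies are within O(n / q) of A on average, and d = 4 works.

module Submission where

open import Defs
open import Data.Fin using (Fin; toℕ)
open import Data.List using (List; []; _∷_; map; concatMap; length; _++_; filter; take; drop; upTo; applyUpTo)
open import Data.List.Properties using (map-++; length-++; map-upTo; ++-identityʳ; length-take; take++drop≡id; length-filter; filter-accept; filter-reject)
open import Data.List.Relation.Binary.Permutation.Propositional using (_↭_; ↭-refl; ↭-trans; prep; swap)
open import Data.List.Relation.Binary.Permutation.Propositional.Properties using (map⁺; ↭-length; filter-↭)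
open import Data.Nat using (ℕ; zero; suc; _+_; _*_; _∸_; _^_; _≤_; _<_; z≤n; s≤s; _≤?_; _<?_; _≟_; NonZero; >-nonZero)
open import Data.Nat.Base using (_!; ∣_-_∣)
open import Data.Nat.DivMod using (_/_; m*n/n≡m; m/n*n≤m; /-monoˡ-≤)
open import Data.Nat.ListAction using (sum)
open import Data.Nat.ListAction.Properties using (sum-++; sum-↭)
open import Data.Nat.Properties
open import Data.Nat.Tactic.RingSolver using (solve-∀)
open import Data.Product using (Σ; _×_; _,_; proj₁; proj₂)
open import Data.Sum using (inj₁; inj₂)
open import Data.Vec using (Vec; _∷_; tabulate)
open import Data.Vec.Properties using (tabulate-cong)
open import Function using (_∘_)
open import Relation.Binary.PropositionalEquality using (_≡_; _≢_; refl; sym; trans; cong; cong₂; subst; module ≡-Reasoning)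
open import Relation.Nullary using (Dec; yes; no; contradiction)

-- Averages are kept as integer sums over all drawings without replacement, so an inequality between
-- means becomes one between `pick` sums, with falling factorials counting the drawings. The choice
-- of q answers two demands. A sample or remainder of size s fixes the relative group sizes up to
-- order 1 / sqrt s, so a relative error of 1 / q asks for q² ≤ s. The sample itself may cost k s
-- comparisons, so the same error asks for q s ≤ n. With s about n^(3/4) the second demand forces q
-- to be about n^(1/4), and the first then holds with room to spare. For the adaptive strategy the
-- condition on the remainder fails in the last q² steps. These are given up entirely, at a price of
-- k q² ≤ k n / q, because q³ ≤ n. Only the remainder of a draw is analysed: sample and remainder
-- deviate from proportion by the same amount, so one variance bound serves both strategies.

-- Sums over lists and over removals of one entry.

sumMap : (ℕ → ℕ) → List ℕ → ℕ
sumMap f xs = sum (map f xs)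

sumMap-↭ : ∀ f {xs ys} → xs ↭ ys → sumMap f xs ≡ sumMap f ys
sumMap-↭ f p = sum-↭ (map⁺ f p)

sumMap-++ : ∀ f xs ys → sumMap f (xs ++ ys) ≡ sumMap f xs + sumMap f ys
sumMap-++ f xs ys = trans (cong sum (map-++ f xs ys)) (sum-++ (map f xs) (map f ys))

sumMap-≤ : ∀ f {c} → (∀ x → f x ≤ c) → ∀ xs → sumMap f xs ≤ length xs * c
sumMap-≤ f f≤c []       = z≤n
sumMap-≤ f f≤c (x ∷ xs) = +-mono-≤ (f≤c x) (sumMap-≤ f f≤c xs)

+-interchange : ∀ a b c d → (a + b) + (c + d) ≡ (a + c) + (b + d)
+-interchange = solve-∀

-- sumSel xs G sums G x r over all ways of removing one occurrence x from xs, leaving r.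
sumSel : List ℕ → (ℕ → List ℕ → ℕ) → ℕ
sumSel []       G = 0
sumSel (x ∷ xs) G = G x xs + sumSel xs (λ y r → G y (x ∷ r))

sumSel-mono : ∀ xs {G H} → (∀ x r → x ∷ r ↭ xs → G x r ≤ H x r) → sumSel xs G ≤ sumSel xs H
sumSel-mono []       G≤H = z≤n
sumSel-mono (x ∷ xs) G≤H = +-mono-≤ (G≤H x xs ↭-refl)
  (sumSel-mono xs λ y r p → G≤H y (x ∷ r) (↭-trans (swap y x ↭-refl) (prep x p)))

sumSel-cong : ∀ xs {G H} → (∀ x r → x ∷ r ↭ xs → G x r ≡ H x r) → sumSel xs G ≡ sumSel xs H
sumSel-cong xs G≡H = ≤-antisym
  (sumSel-mono xs λ x r p → ≤-reflexive (G≡H x r p))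
  (sumSel-mono xs λ x r p → ≤-reflexive (sym (G≡H x r p)))

sumSel-+ : ∀ xs G H → sumSel xs (λ x r → G x r + H x r) ≡ sumSel xs G + sumSel xs H
sumSel-+ []       G H = refl
sumSel-+ (x ∷ xs) G H = trans
  (cong (G x xs + H x xs +_) (sumSel-+ xs (λ y r → G y (x ∷ r)) (λ y r → H y (x ∷ r))))
  (+-interchange (G x xs) _ _ _)

sumSel-* : ∀ xs c G → sumSel xs (λ x r → c * G x r) ≡ c * sumSel xs G
sumSel-* []       c G = sym (*-zeroʳ c)
sumSel-* (x ∷ xs) c G = trans
  (cong (c * G x xs +_) (sumSel-* xs c (λ y r → G y (x ∷ r))))
  (sym (*-distribˡ-+ c _ _))

sumSel-const : ∀ xs c → sumSel xs (λ _ _ → c) ≡ length xs * c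
sumSel-const []       c = refl
sumSel-const (x ∷ xs) c = cong (c +_) (sumSel-const xs c)

sumSel-head : ∀ f xs → sumSel xs (λ x _ → f x) ≡ sumMap f xs
sumSel-head f []       = refl
sumSel-head f (x ∷ xs) = cong (f x +_) (sumSel-head f xs)

-- Each entry survives every removal but its own.
sumSel-sumMap : ∀ f xs → sumSel xs (λ _ r → sumMap f r) ≡ (length xs ∸ 1) * sumMap f xs
sumSel-sumMap f []           = refl
sumSel-sumMap f (x ∷ [])     = refl
sumSel-sumMap f (x ∷ xs@(y ∷ ys)) = begin
  sumMap f xs + sumSel xs (λ _ r → f x + sumMap f r)
    ≡⟨ cong (sumMap f xs +_) (sumSel-+ xs (λ _ _ → f x) (λ _ r → sumMap f r)) ⟩
  sumMap f xs + (sumSel xs (λ _ _ → f x) + sumSel xs (λ _ r → sumMap f r))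
    ≡⟨ cong (sumMap f xs +_) (cong₂ _+_ (sumSel-const xs (f x)) (sumSel-sumMap f xs)) ⟩
  sumMap f xs + (suc (length ys) * f x + length ys * sumMap f xs)
    ≡⟨ arith (length ys) (f x) (sumMap f xs) ⟩
  suc (length ys) * (f x + sumMap f xs) ∎
  where
  open ≡-Reasoning
  arith : ∀ l a t → t + (suc l * a + l * t) ≡ suc l * (a + t)
  arith = solve-∀

-- The second elementary symmetric polynomial of the values of f; for an indicator it is the number
-- of pairs of hits.
pairSum : (ℕ → ℕ) → List ℕ → ℕ
pairSum f []       = 0
pairSum f (x ∷ xs) = f x * sumMap f xs + pairSum f xs

-- A pair is destroyed only by removing one of its two members. Lists shorter than three are base
-- cases because truncated subtraction does not follow the recurrence there.
sumSel-pairSum : ∀ f xs → sumSel xs (λ _ r → pairSum f r) ≡ (length xs ∸ 2) * pairSum f xs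
sumSel-pairSum f []           = refl
sumSel-pairSum f (x ∷ [])     = refl
sumSel-pairSum f (x ∷ y ∷ []) rewrite *-zeroʳ (f x) | *-zeroʳ (f y) = refl
sumSel-pairSum f (x ∷ xs@(y ∷ ys@(z ∷ zs))) = begin
  pairSum f xs + sumSel xs (λ _ r → f x * sumMap f r + pairSum f r)
    ≡⟨ cong (pairSum f xs +_) (sumSel-+ xs (λ _ r → f x * sumMap f r) (λ _ r → pairSum f r)) ⟩
  pairSum f xs + (sumSel xs (λ _ r → f x * sumMap f r) + sumSel xs (λ _ r → pairSum f r))
    ≡⟨ cong (pairSum f xs +_) (cong₂ _+_
         (trans (sumSel-* xs (f x) (λ _ r → sumMap f r)) (cong (f x *_) (sumSel-sumMap f xs)))
         (sumSel-pairSum f xs)) ⟩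
  pairSum f xs + (f x * (suc (length zs) * sumMap f xs) + length zs * pairSum f xs)
    ≡⟨ arith (length zs) (f x) (sumMap f xs) (pairSum f xs) ⟩
  suc (length zs) * (f x * sumMap f xs + pairSum f xs) ∎
  where
  open ≡-Reasoning
  arith : ∀ l a t p → p + (a * (suc l * t) + l * p) ≡ suc l * (a * t + p)
  arith = solve-∀

-- Idempotence turns the diagonal of the square into the count itself. The second moment of a count
-- thus reduces to statistics of degree one and two, both of which behave well under removal.
sumMap-square : ∀ f → (∀ x → f x * f x ≡ f x) → ∀ xs →
  sumMap f xs * sumMap f xs ≡ sumMap f xs + 2 * pairSum f xs
sumMap-square f idem []       = refl
sumMap-square f idem (x ∷ xs) = begin
  (f x + sumMap f xs) * (f x + sumMap f xs)
    ≡⟨ expand (f x) (sumMap f xs) ⟩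
  f x * f x + (2 * (f x * sumMap f xs) + sumMap f xs * sumMap f xs)
    ≡⟨ cong₂ (λ a b → a + (2 * (f x * sumMap f xs) + b)) (idem x) (sumMap-square f idem xs) ⟩
  f x + (2 * (f x * sumMap f xs) + (sumMap f xs + 2 * pairSum f xs))
    ≡⟨ collect (f x) (sumMap f xs) (pairSum f xs) ⟩
  f x + sumMap f xs + 2 * (f x * sumMap f xs + pairSum f xs) ∎
  where
  open ≡-Reasoning
  expand : ∀ a t → (a + t) * (a + t) ≡ a * a + (2 * (a * t) + t * t)
  expand = solve-∀
  collect : ∀ a t p → a + (2 * (a * t) + (t + 2 * p)) ≡ a + t + 2 * (a * t + p)
  collect = solve-∀

-- Drawing without replacement and falling factorials.

-- pick v xs F sums F ys r over all ways of drawing a sequence ys of v elements from xs, leaving r.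
pick : ℕ → List ℕ → (List ℕ → List ℕ → ℕ) → ℕ
pick zero    xs F = F [] xs
pick (suc v) xs F = sumSel xs (λ x r → pick v r (λ ys → F (x ∷ ys)))

pick-mono : ∀ v xs {F G} →
  (∀ ys r → length ys ≡ v → ys ++ r ↭ xs → F ys r ≤ G ys r) → pick v xs F ≤ pick v xs G
pick-mono zero    xs F≤G = F≤G [] xs refl ↭-refl
pick-mono (suc v) xs F≤G = sumSel-mono xs λ x r p → pick-mono v r λ ys r′ l p′ →
  F≤G (x ∷ ys) r′ (cong suc l) (↭-trans (prep x p′) p)

pick-cong : ∀ v xs {F G} →
  (∀ ys r → length ys ≡ v → ys ++ r ↭ xs → F ys r ≡ G ys r) → pick v xs F ≡ pick v xs G
pick-cong v xs F≡G = ≤-antisym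
  (pick-mono v xs λ ys r l p → ≤-reflexive (F≡G ys r l p))
  (pick-mono v xs λ ys r l p → ≤-reflexive (sym (F≡G ys r l p)))

pick-split : ∀ v w xs F →
  pick (v + w) xs F ≡ pick v xs (λ ys r → pick w r (λ zs → F (ys ++ zs)))
pick-split zero    w xs F = refl
pick-split (suc v) w xs F = sumSel-cong xs λ x r _ → pick-split v w r (λ ys → F (x ∷ ys))

pick-+ : ∀ v xs F G → pick v xs (λ ys r → F ys r + G ys r) ≡ pick v xs F + pick v xs G
pick-+ zero    xs F G = refl
pick-+ (suc v) xs F G = trans
  (sumSel-cong xs λ x r _ → pick-+ v r (λ ys → F (x ∷ ys)) (λ ys → G (x ∷ ys)))
  (sumSel-+ xs _ _)

pick-* : ∀ v xs c F → pick v xs (λ ys r → c * F ys r) ≡ c * pick v xs F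
pick-* zero    xs c F = refl
pick-* (suc v) xs c F = trans
  (sumSel-cong xs λ x r _ → pick-* v r c (λ ys → F (x ∷ ys)))
  (sumSel-* xs c _)

falling : ℕ → ℕ → ℕ
falling m       zero    = 1
falling zero    (suc v) = 0
falling (suc m) (suc v) = suc m * falling m v

falling-pred : ∀ m v → falling m (suc v) ≡ m * falling (m ∸ 1) v
falling-pred zero    v = refl
falling-pred (suc m) v = refl

-- The definition peels off the largest factor; here the smallest one is split off, which compares v
-- and v + 1 draws from the same population.
falling-sucʳ : ∀ v r → falling (v + r) (suc v) ≡ r * falling (v + r) v
falling-sucʳ zero    zero    = refl
falling-sucʳ zero    (suc r) = refl
falling-sucʳ (suc v) r = trans
  (cong (suc (v + r) *_) (falling-sucʳ v r))
  (arith (suc (v + r)) r (falling (v + r) v))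
  where
  arith : ∀ a b c → a * (b * c) ≡ b * (a * c)
  arith = solve-∀

falling-! : ∀ v r → falling (v + r) v * r ! ≡ (v + r) !
falling-! zero    r = +-identityʳ (r !)
falling-! (suc v) r = trans (*-assoc (suc (v + r)) (falling (v + r) v) (r !)) (cong (suc (v + r) *_) (falling-! v r))

falling-full : ∀ m → falling m m ≡ m !
falling-full zero    = refl
falling-full (suc m) = cong (suc m *_) (falling-full m)

length-rest : ∀ {x : ℕ} {r xs} → x ∷ r ↭ xs → length r ≡ length xs ∸ 1
length-rest p = cong (_∸ 1) (↭-length p)

pick-const : ∀ v xs c → pick v xs (λ _ _ → c) ≡ falling (length xs) v * c
pick-const zero    xs c = sym (+-identityʳ c)
pick-const (suc v) xs c = begin
  sumSel xs (λ _ r → pick v r (λ _ _ → c))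
    ≡⟨ sumSel-cong xs (λ x r p → trans (pick-const v r c)
         (cong (λ l → falling l v * c) (length-rest p))) ⟩
  sumSel xs (λ _ _ → falling (length xs ∸ 1) v * c)
    ≡⟨ sumSel-const xs _ ⟩
  length xs * (falling (length xs ∸ 1) v * c)
    ≡⟨ *-assoc (length xs) _ _ ⟨
  length xs * falling (length xs ∸ 1) v * c
    ≡⟨ cong (_* c) (falling-pred (length xs) v) ⟨
  falling (length xs) (suc v) * c ∎
  where open ≡-Reasoning

-- Up to normalisation, a degree-j symmetric statistic is an eigenfunction of the removal of a random element.
pick-eigen : ∀ j (Φ : List ℕ → ℕ) →
  (∀ xs → sumSel xs (λ _ r → Φ r) ≡ (length xs ∸ j) * Φ xs) →
  ∀ v xs → pick v xs (λ _ r → Φ r) ≡ falling (length xs ∸ j) v * Φ xs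
pick-eigen j Φ eigen zero    xs = sym (+-identityʳ (Φ xs))
pick-eigen j Φ eigen (suc v) xs = begin
  sumSel xs (λ _ r → pick v r (λ _ r′ → Φ r′))
    ≡⟨ sumSel-cong xs (λ x r p → trans (pick-eigen j Φ eigen v r)
         (cong (λ l → falling (l ∸ j) v * Φ r) (length-rest p))) ⟩
  sumSel xs (λ _ r → falling (length xs ∸ 1 ∸ j) v * Φ r)
    ≡⟨ sumSel-* xs (falling (length xs ∸ 1 ∸ j) v) (λ _ r → Φ r) ⟩
  falling (length xs ∸ 1 ∸ j) v * sumSel xs (λ _ r → Φ r)
    ≡⟨ cong₂ _*_ (cong (λ l → falling l v) (∸-comm (length xs))) (eigen xs) ⟩
  falling (length xs ∸ j ∸ 1) v * ((length xs ∸ j) * Φ xs)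
    ≡⟨ arith (falling (length xs ∸ j ∸ 1) v) (length xs ∸ j) (Φ xs) ⟩
  (length xs ∸ j) * falling (length xs ∸ j ∸ 1) v * Φ xs
    ≡⟨ cong (_* Φ xs) (falling-pred (length xs ∸ j) v) ⟨
  falling (length xs ∸ j) (suc v) * Φ xs ∎
  where
  open ≡-Reasoning
  arith : ∀ a b c → a * (b * c) ≡ b * a * c
  arith = solve-∀
  ∸-comm : ∀ l → l ∸ 1 ∸ j ≡ l ∸ j ∸ 1
  ∸-comm l = trans (∸-+-assoc l 1 j) (trans (cong (l ∸_) (+-comm 1 j)) (sym (∸-+-assoc l j 1)))

-- Permutations as complete drawings.

sum-concatMap : ∀ {A : Set} (F : List ℕ → ℕ) (h : A → List (List ℕ)) as →
  sum (map F (concatMap h as)) ≡ sum (map (λ a → sum (map F (h a))) as)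
sum-concatMap F h []       = refl
sum-concatMap F h (a ∷ as) = begin
  sum (map F (h a ++ concatMap h as))
    ≡⟨ cong sum (map-++ F (h a) _) ⟩
  sum (map F (h a) ++ map F (concatMap h as))
    ≡⟨ sum-++ (map F (h a)) _ ⟩
  sum (map F (h a)) + sum (map F (concatMap h as))
    ≡⟨ cong (sum (map F (h a)) +_) (sum-concatMap F h as) ⟩
  sum (map F (h a)) + sum (map (λ b → sum (map F (h b))) as) ∎
  where open ≡-Reasoning

sum-map-map : ∀ (F : List ℕ → ℕ) y ls → sum (map F (map (y ∷_) ls)) ≡ sum (map (λ e → F (y ∷ e)) ls)
sum-map-map F y []       = refl
sum-map-map F y (l ∷ ls) = cong (F (y ∷ l) +_) (sum-map-map F y ls)

-- Both sides run over the orderings of `x ∷ xs`. Either x is drawn first, or the first draw y is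
-- absorbed into F and induction treats the rest; these are the two parts of `insertions`.
pick-insertions : ∀ F x xs n → length xs ≡ n →
  pick (suc n) (x ∷ xs) (λ ys _ → F ys) ≡ pick n xs (λ ys _ → sum (map F (insertions x ys)))
pick-insertions F x []       zero    l = refl
pick-insertions F x xs       (suc n) l = begin
  pick (suc n) xs (λ ys _ → F (x ∷ ys))
    + sumSel xs (λ y r → pick (suc n) (x ∷ r) (λ ys _ → F (y ∷ ys)))
    ≡⟨ cong (pick (suc n) xs (λ ys _ → F (x ∷ ys)) +_) (sumSel-cong xs λ y r p →
         trans (pick-insertions (λ ys → F (y ∷ ys)) x r n (trans (length-rest p) (cong (_∸ 1) l)))
               (pick-cong n r λ ys _ _ _ → sym (sum-map-map F y (insertions x ys)))) ⟩
  sumSel xs (λ y r → pick n r (λ ys _ → F (x ∷ y ∷ ys)))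
    + sumSel xs (λ y r → pick n r (λ ys _ → sum (map F (map (y ∷_) (insertions x ys)))))
    ≡⟨ sumSel-+ xs _ _ ⟨
  sumSel xs (λ y r → pick n r (λ ys _ → F (x ∷ y ∷ ys))
    + pick n r (λ ys _ → sum (map F (map (y ∷_) (insertions x ys)))))
    ≡⟨ sumSel-cong xs (λ y r _ → sym (pick-+ n r _ _)) ⟩
  pick (suc n) xs (λ ys _ → sum (map F (insertions x ys))) ∎
  where open ≡-Reasoning

-- The order mirrors `perms`, which inserts the largest number last: that number sits at the head,
-- where `pick-insertions` takes it.
descending : ℕ → List ℕ
descending zero    = []
descending (suc n) = suc n ∷ descending n

length-descending : ∀ n → length (descending n) ≡ n
length-descending zero    = refl
length-descending (suc n) = cong suc (length-descending n)

sum-perms : ∀ n F → sum (map F (perms n)) ≡ pick n (descending n) (λ ys _ → F ys)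
sum-perms zero    F = +-identityʳ (F [])
sum-perms (suc n) F = begin
  sum (map F (concatMap (insertions (suc n)) (perms n)))
    ≡⟨ sum-concatMap F (insertions (suc n)) (perms n) ⟩
  sum (map (λ e → sum (map F (insertions (suc n) e))) (perms n))
    ≡⟨ sum-perms n _ ⟩
  pick n (descending n) (λ ys _ → sum (map F (insertions (suc n) ys)))
    ≡⟨ pick-insertions F (suc n) (descending n) n (length-descending n) ⟨
  pick (suc n) (descending (suc n)) (λ ys _ → F ys) ∎
  where open ≡-Reasoning

-- Second moments of hypergeometric deviations.

square-∣-∣-≤ : ∀ {x y} → x ≤ y → ∣ x - y ∣ * ∣ x - y ∣ + 2 * (x * y) ≡ x * x + y * y
square-∣-∣-≤ {x} {y} x≤y with m≤n⇒∃[o]m+o≡n x≤y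
... | e , refl rewrite ∣m-m+n∣≡n x e = arith x e
  where
  arith : ∀ x e → e * e + 2 * (x * (x + e)) ≡ x * x + (x + e) * (x + e)
  arith = solve-∀

square-∣-∣ : ∀ x y → ∣ x - y ∣ * ∣ x - y ∣ + 2 * (x * y) ≡ x * x + y * y
square-∣-∣ x y with ≤-total x y
... | inj₁ x≤y = square-∣-∣-≤ x≤y
... | inj₂ y≤x rewrite ∣-∣-comm x y | *-comm x y | +-comm (x * x) (y * y) = square-∣-∣-≤ y≤x

2xy≤x²+y² : ∀ x y → 2 * (x * y) ≤ x * x + y * y
2xy≤x²+y² x y = ≤-trans (m≤n+m _ (∣ x - y ∣ * ∣ x - y ∣)) (≤-reflexive (square-∣-∣ x y))

-- `N₁` and `N₂` stand for the numbers of draws that leave one given entry, or two given entries, in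
-- the remainder. The factor `m₁` clears the denominator of `N₂`. The exact identity has
-- `N * r * v * (2 * p)` as a surplus on the left, and dropping it gives the bound.
variance-arith : ∀ S N N₁ N₂ v r′ a p → let m₁ = v + r′; m = suc m₁; r = suc r′ in
  S + 2 * m * r * a * (N₁ * a) ≡ m * m * (N₁ * a + 2 * (N₂ * p)) + N * (r * a * (r * a)) →
  m * N₁ ≡ r * N → m * (m₁ * N₂) ≡ r′ * (r * N) → a * a ≡ a + 2 * p →
  m₁ * S ≤ m₁ * (N * (r * v * a))
variance-arith S N N₁ N₂ v r′ a p balance eq₁ eq₂ eqa =
  ≤-trans (m≤m+n (m₁ * S) (N * r * v * (2 * p))) (≤-reflexive (+-cancelʳ-≡ Z _ _ key))
  where
  open ≡-Reasoning
  m₁ = v + r′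
  m = suc m₁
  r = suc r′
  -- The cross term of the square: it is added to both sides and cancelled, since subtraction on
  -- naturals truncates.
  Z = m₁ * (2 * r * (r * N) * (a * a))
  s₁ : ∀ m₁ S w m r a N₁ → m₁ * S + w + m₁ * (2 * r * (m * N₁) * (a * a)) ≡ m₁ * (S + 2 * m * r * a * (N₁ * a)) + w
  s₁ = solve-∀
  s₂ : ∀ m₁ m N₁ N₂ a p N r w →
    m₁ * (m * m * (N₁ * a + 2 * (N₂ * p)) + N * (r * a * (r * a))) + w
    ≡ m₁ * m * (m * N₁) * a + 2 * m * p * (m * (m₁ * N₂)) + m₁ * N * r * r * (a * a) + w
  s₂ = solve-∀
  s₃ : ∀ v r′ N a p → let m₁ = v + r′; m = suc m₁; r = suc r′ in
    m₁ * m * (r * N) * a + 2 * m * p * (r′ * (r * N)) + m₁ * N * r * r * (a + 2 * p) + N * r * v * (2 * p)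
    ≡ m₁ * (N * (r * v * a)) + m₁ * (2 * r * (r * N) * (a + 2 * p))
  s₃ = solve-∀
  key : m₁ * S + N * r * v * (2 * p) + Z ≡ m₁ * (N * (r * v * a)) + Z
  key = begin
    m₁ * S + N * r * v * (2 * p) + Z
      ≡⟨ cong (λ t → m₁ * S + N * r * v * (2 * p) + m₁ * (2 * r * t * (a * a))) eq₁ ⟨
    m₁ * S + N * r * v * (2 * p) + m₁ * (2 * r * (m * N₁) * (a * a))
      ≡⟨ s₁ m₁ S _ m r a N₁ ⟩
    m₁ * (S + 2 * m * r * a * (N₁ * a)) + N * r * v * (2 * p)
      ≡⟨ cong (λ t → m₁ * t + N * r * v * (2 * p)) balance ⟩
    m₁ * (m * m * (N₁ * a + 2 * (N₂ * p)) + N * (r * a * (r * a))) + N * r * v * (2 * p)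
      ≡⟨ s₂ m₁ m N₁ N₂ a p N r _ ⟩
    m₁ * m * (m * N₁) * a + 2 * m * p * (m * (m₁ * N₂)) + m₁ * N * r * r * (a * a) + N * r * v * (2 * p)
      ≡⟨ cong₂ (λ t u → m₁ * m * t * a + 2 * m * p * u + m₁ * N * r * r * (a * a) + N * r * v * (2 * p)) eq₁ eq₂ ⟩
    m₁ * m * (r * N) * a + 2 * m * p * (r′ * (r * N)) + m₁ * N * r * r * (a * a) + N * r * v * (2 * p)
      ≡⟨ cong (λ t → m₁ * m * (r * N) * a + 2 * m * p * (r′ * (r * N)) + m₁ * N * r * r * t + N * r * v * (2 * p)) eqa ⟩
    m₁ * m * (r * N) * a + 2 * m * p * (r′ * (r * N)) + m₁ * N * r * r * (a + 2 * p) + N * r * v * (2 * p)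
      ≡⟨ s₃ v r′ N a p ⟩
    m₁ * (N * (r * v * a)) + m₁ * (2 * r * (r * N) * (a + 2 * p))
      ≡⟨ cong (λ t → m₁ * (N * (r * v * a)) + m₁ * (2 * r * (r * N) * t)) eqa ⟨
    m₁ * (N * (r * v * a)) + Z ∎

-- Here `r = suc r′` is the size of the remainder after v draws from a population of size m. The
-- parameter `m′` records that m is at least 2, so that the factor `m₁` can be cancelled.
module _ (f : ℕ → ℕ) (idem : ∀ x → f x * f x ≡ f x) (xs : List ℕ)
         (v r′ m′ : ℕ) (|xs| : length xs ≡ suc (suc m′)) (v+r′ : v + r′ ≡ suc m′) where

  private
    m₁ = v + r′
    m = suc m₁
    r = suc r′
    a = sumMap f xs
    p = pairSum f xs
    N = falling m v
    D : List ℕ → ℕ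
    D ys = ∣ m * sumMap f ys - r * a ∣
    lenxs : length xs ≡ m
    lenxs = trans |xs| (cong suc (sym v+r′))

    first : pick v xs (λ _ ys → sumMap f ys) ≡ falling m₁ v * a
    first = trans (pick-eigen 1 (sumMap f) (sumSel-sumMap f) v xs)
                  (cong (λ l → falling (l ∸ 1) v * a) lenxs)

    second : pick v xs (λ _ ys → pairSum f ys) ≡ falling (m₁ ∸ 1) v * p
    second = trans (pick-eigen 2 (pairSum f) (sumSel-pairSum f) v xs)
                   (cong (λ l → falling (l ∸ 2) v * p) lenxs)

    pointwise : ∀ ys → D ys * D ys + 2 * m * r * a * sumMap f ys
      ≡ m * m * (sumMap f ys + 2 * pairSum f ys) + r * a * (r * a)
    pointwise ys = begin
      D ys * D ys + 2 * m * r * a * sumMap f ys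
        ≡⟨ cong (D ys * D ys +_) (s₁ m r a (sumMap f ys)) ⟩
      D ys * D ys + 2 * (m * sumMap f ys * (r * a))
        ≡⟨ square-∣-∣ (m * sumMap f ys) (r * a) ⟩
      m * sumMap f ys * (m * sumMap f ys) + r * a * (r * a)
        ≡⟨ cong (_+ r * a * (r * a)) (s₂ m (sumMap f ys)) ⟩
      m * m * (sumMap f ys * sumMap f ys) + r * a * (r * a)
        ≡⟨ cong (λ t → m * m * t + r * a * (r * a)) (sumMap-square f idem ys) ⟩
      m * m * (sumMap f ys + 2 * pairSum f ys) + r * a * (r * a) ∎
      where
      open ≡-Reasoning
      s₁ : ∀ m r a c → 2 * m * r * a * c ≡ 2 * (m * c * (r * a))
      s₁ = solve-∀
      s₂ : ∀ m c → m * c * (m * c) ≡ m * m * (c * c)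
      s₂ = solve-∀

    S = pick v xs (λ _ ys → D ys * D ys)

    balance : S + 2 * m * r * a * (falling m₁ v * a)
      ≡ m * m * (falling m₁ v * a + 2 * (falling (m₁ ∸ 1) v * p)) + N * (r * a * (r * a))
    balance = begin
      S + 2 * m * r * a * (falling m₁ v * a)
        ≡⟨ cong (λ t → S + 2 * m * r * a * t) first ⟨
      S + 2 * m * r * a * pick v xs (λ _ ys → sumMap f ys)
        ≡⟨ cong (S +_) (pick-* v xs (2 * m * r * a) (λ _ ys → sumMap f ys)) ⟨
      S + pick v xs (λ _ ys → 2 * m * r * a * sumMap f ys)
        ≡⟨ pick-+ v xs _ _ ⟨
      pick v xs (λ _ ys → D ys * D ys + 2 * m * r * a * sumMap f ys)
        ≡⟨ pick-cong v xs (λ _ ys _ _ → pointwise ys) ⟩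
      pick v xs (λ _ ys → m * m * (sumMap f ys + 2 * pairSum f ys) + r * a * (r * a))
        ≡⟨ pick-+ v xs _ _ ⟩
      pick v xs (λ _ ys → m * m * (sumMap f ys + 2 * pairSum f ys)) + pick v xs (λ _ _ → r * a * (r * a))
        ≡⟨ cong₂ _+_
             (trans (pick-* v xs (m * m) (λ _ ys → sumMap f ys + 2 * pairSum f ys))
               (cong (m * m *_) (trans (pick-+ v xs (λ _ ys → sumMap f ys) (λ _ ys → 2 * pairSum f ys))
                 (cong₂ _+_ first (trans (pick-* v xs 2 (λ _ ys → pairSum f ys)) (cong (2 *_) second))))))
             (trans (pick-const v xs (r * a * (r * a))) (cong (λ l → falling l v * (r * a * (r * a))) lenxs)) ⟩
      m * m * (falling m₁ v * a + 2 * (falling (m₁ ∸ 1) v * p)) + N * (r * a * (r * a)) ∎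
      where open ≡-Reasoning

    eq₁ : m * falling m₁ v ≡ r * N
    eq₁ = subst (λ l → falling l (suc v) ≡ r * falling l v) (+-suc v r′) (falling-sucʳ v r)

    eq₂ : m * (m₁ * falling (m₁ ∸ 1) v) ≡ r′ * (r * N)
    eq₂ = trans (cong (m *_) (sym (falling-pred m₁ v)))
          (trans (falling-sucʳ (suc v) r′) (cong (r′ *_) eq₁))

  -- Hypergeometric variance: the sharp value is N r v a (m − a) / (m − 1).
  variance-≤ : S ≤ N * (r * v * a)
  variance-≤ = *-cancelˡ-≤ (suc m′) (subst (λ t → t * S ≤ t * (N * (r * v * a))) v+r′
    (variance-arith S N (falling m₁ v) (falling (m₁ ∸ 1) v) v r′ a p balance eq₁ eq₂
      (sumMap-square f idem xs)))

-- AM–GM 2 (q D) (w m) ≤ (q D)² + (w m)² takes the place of Cauchy–Schwarz, which would need square roots.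
pick-deviation : ∀ v xs (D : List ℕ → List ℕ → ℕ) q w′ m′ {l} → length xs ≡ l →
  let w = suc w′; m = suc m′; N = falling l v in
  pick v xs (λ ys r → D ys r * D ys r) ≤ N * (w * m * m) → q * q ≤ w →
  q * pick v xs D ≤ N * (w * m)
pick-deviation v xs D q w′ m′ refl variance q²≤w = *-cancelˡ-≤ (2 * (w * m)) (begin
  2 * (w * m) * (q * pick v xs D)
    ≡⟨ *-assoc (2 * (w * m)) q (pick v xs D) ⟨
  2 * (w * m) * q * pick v xs D
    ≡⟨ pick-* v xs (2 * (w * m) * q) D ⟨
  pick v xs (λ ys r → 2 * (w * m) * q * D ys r)
    ≤⟨ pick-mono v xs (λ ys r _ _ → amgm (D ys r)) ⟩
  pick v xs (λ ys r → q * q * (D ys r * D ys r) + w * m * (w * m))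
    ≡⟨ pick-+ v xs (λ ys r → q * q * (D ys r * D ys r)) (λ _ _ → w * m * (w * m)) ⟩
  pick v xs (λ ys r → q * q * (D ys r * D ys r)) + pick v xs (λ _ _ → w * m * (w * m))
    ≡⟨ cong₂ _+_ (pick-* v xs (q * q) (λ ys r → D ys r * D ys r)) (pick-const v xs (w * m * (w * m))) ⟩
  q * q * pick v xs (λ ys r → D ys r * D ys r) + N * (w * m * (w * m))
    ≤⟨ +-monoˡ-≤ _ (*-mono-≤ q²≤w variance) ⟩
  w * (N * (w * m * m)) + N * (w * m * (w * m))
    ≡⟨ s₂ w m N ⟩
  2 * (w * m) * (N * (w * m)) ∎)
  where
  open ≤-Reasoning
  w = suc w′
  m = suc m′
  N = falling (length xs) v
  s₁ : ∀ w m q d → 2 * (w * m) * q * d ≡ 2 * (q * d * (w * m))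
  s₁ = solve-∀
  s₂ : ∀ w m N → w * (N * (w * m * m)) + N * (w * m * (w * m)) ≡ 2 * (w * m) * (N * (w * m))
  s₂ = solve-∀
  s₃ : ∀ q d → q * d * (q * d) ≡ q * q * (d * d)
  s₃ = solve-∀
  amgm : ∀ d → 2 * (w * m) * q * d ≤ q * q * (d * d) + w * m * (w * m)
  amgm d = begin
    2 * (w * m) * q * d ≡⟨ s₁ w m q d ⟩
    2 * (q * d * (w * m)) ≤⟨ 2xy≤x²+y² (q * d) (w * m) ⟩
    q * d * (q * d) + w * m * (w * m) ≡⟨ cong (_+ w * m * (w * m)) (s₃ q d) ⟩
    q * q * (d * d) + w * m * (w * m) ∎

-- Depths, indexed sums and count vectors.

depth-≤ : ∀ {k} (t : Tree k) i → depth t i ≤ k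
depth-≤ leaf i = z≤n
depth-≤ (node {l} {r} L R) i with i ≤? l
... | yes _ = s≤s (≤-trans (depth-≤ L i) (m≤m+n l r))
... | no _  = s≤s (≤-trans (depth-≤ R (i ∸ suc l)) (m≤n+m r l))

Σ< : ℕ → (ℕ → ℕ) → ℕ
Σ< zero    f = 0
Σ< (suc n) f = f 0 + Σ< n (f ∘ suc)

sum-upTo : ∀ n f → sum (map f (upTo n)) ≡ Σ< n f
sum-upTo n f = trans (cong sum (map-upTo f n)) (lemma n f)
  where
  lemma : ∀ n f → sum (applyUpTo f n) ≡ Σ< n f
  lemma zero    f = refl
  lemma (suc n) f = cong (f 0 +_) (lemma n (f ∘ suc))

Σ<-cong : ∀ n {f g} → (∀ i → i < n → f i ≡ g i) → Σ< n f ≡ Σ< n g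
Σ<-cong zero    f≡g = refl
Σ<-cong (suc n) f≡g = cong₂ _+_ (f≡g 0 (s≤s z≤n)) (Σ<-cong n λ i i<n → f≡g (suc i) (s≤s i<n))

Σ<-mono : ∀ n {f g} → (∀ i → f i ≤ g i) → Σ< n f ≤ Σ< n g
Σ<-mono zero    f≤g = z≤n
Σ<-mono (suc n) f≤g = +-mono-≤ (f≤g 0) (Σ<-mono n (f≤g ∘ suc))

Σ<-+ : ∀ n f g → Σ< n (λ i → f i + g i) ≡ Σ< n f + Σ< n g
Σ<-+ zero    f g = refl
Σ<-+ (suc n) f g = trans (cong (f 0 + g 0 +_) (Σ<-+ n (f ∘ suc) (g ∘ suc))) (+-interchange (f 0) _ _ _)

Σ<-* : ∀ n c f → Σ< n (λ i → c * f i) ≡ c * Σ< n f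
Σ<-* zero    c f = sym (*-zeroʳ c)
Σ<-* (suc n) c f = trans (cong (c * f 0 +_) (Σ<-* n c (f ∘ suc))) (sym (*-distribˡ-+ c _ _))

Σ<-const : ∀ n c → Σ< n (λ _ → c) ≡ n * c
Σ<-const zero    c = refl
Σ<-const (suc n) c = cong (c +_) (Σ<-const n c)

pick-Σ< : ∀ v xs n (D : ℕ → List ℕ → List ℕ → ℕ) →
  pick v xs (λ ys r → Σ< n (λ h → D h ys r)) ≡ Σ< n (λ h → pick v xs (D h))
pick-Σ< v xs zero    D = trans (pick-const v xs 0) (*-zeroʳ (falling (length xs) v))
pick-Σ< v xs (suc n) D = trans (pick-+ v xs (D 0) _) (cong (pick v xs (D 0) +_) (pick-Σ< v xs n (D ∘ suc)))

pick-Σ<-≤ : ∀ v xs n (D : ℕ → List ℕ → List ℕ → ℕ) q b → (∀ h → q * pick v xs (D h) ≤ b) →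
  q * pick v xs (λ ys r → Σ< n (λ h → D h ys r)) ≤ n * b
pick-Σ<-≤ v xs n D q b bound = begin
  q * pick v xs (λ ys r → Σ< n (λ h → D h ys r)) ≡⟨ cong (q *_) (pick-Σ< v xs n D) ⟩
  q * Σ< n (λ h → pick v xs (D h))               ≡⟨ Σ<-* n q _ ⟨
  Σ< n (λ h → q * pick v xs (D h))               ≤⟨ Σ<-mono n bound ⟩
  Σ< n (λ _ → b)                                 ≡⟨ Σ<-const n b ⟩
  n * b                                          ∎
  where open ≤-Reasoning

-- A numerical indicator makes a group count a `sumMap` of an idempotent function, which is what the
-- variance bound takes.
δ : ℕ → ℕ → ℕ
δ zero    zero    = 1
δ zero    (suc j) = 0
δ (suc i) zero    = 0
δ (suc i) (suc j) = δ i j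

δ-idem : ∀ i j → δ i j * δ i j ≡ δ i j
δ-idem zero    zero    = refl
δ-idem zero    (suc j) = refl
δ-idem (suc i) zero    = refl
δ-idem (suc i) (suc j) = δ-idem i j

δ-≤1 : ∀ i j → δ i j ≤ 1
δ-≤1 zero    zero    = ≤-refl
δ-≤1 zero    (suc j) = z≤n
δ-≤1 (suc i) zero    = z≤n
δ-≤1 (suc i) (suc j) = δ-≤1 i j

δ-refl : ∀ i → δ i i ≡ 1
δ-refl zero    = refl
δ-refl (suc i) = δ-refl i

δ-≢ : ∀ i j → j ≢ i → δ i j ≡ 0
δ-≢ zero    zero    j≢i = contradiction refl j≢i
δ-≢ zero    (suc j) j≢i = refl
δ-≢ (suc i) zero    j≢i = refl
δ-≢ (suc i) (suc j) j≢i = δ-≢ i j (j≢i ∘ cong suc)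

Σ<-δ : ∀ n (d : ℕ → ℕ) j → j < n → Σ< n (λ i → d i * δ i j) ≡ d j
Σ<-δ (suc n) d zero    j<n = trans
  (cong₂ _+_ (*-identityʳ (d 0)) (trans (Σ<-cong n λ i _ → *-zeroʳ (d (suc i))) (trans (Σ<-const n 0) (*-zeroʳ n))))
  (+-identityʳ (d 0))
Σ<-δ (suc n) d (suc j) (s≤s j<n) = cong₂ _+_ (*-zeroʳ (d 0)) (Σ<-δ n (d ∘ suc) j j<n)

at-tabulate : ∀ n (f : ℕ → ℕ) i → i < n → at (tabulate {n = n} (f ∘ toℕ)) i ≡ f i
at-tabulate (suc n) f zero    i<n       = refl
at-tabulate (suc n) f (suc i) (s≤s i<n) = at-tabulate n (f ∘ suc) i i<n

-- The hypothesis is additive so that the truncated predecessor in `decAt` is exact at position j.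
decAt-tabulate : ∀ n (f f′ : ℕ → ℕ) j → (∀ i → f i ≡ δ i j + f′ i) →
  decAt (tabulate {n = n} (f ∘ toℕ)) j ≡ tabulate (f′ ∘ toℕ)
decAt-tabulate zero    f f′ j       eq = refl
decAt-tabulate (suc n) f f′ zero    eq = cong₂ _∷_ (cong (_∸ 1) (eq 0)) (tabulate-cong λ i → eq (suc (toℕ i)))
decAt-tabulate (suc n) f f′ (suc j) eq = cong₂ _∷_ (eq 0) (decAt-tabulate n (f ∘ suc) (f′ ∘ suc) j (eq ∘ suc))

-- With x, y the scaled counts of the two parts of a split and z, w their proportional shares, an
-- excess in one part is a deficit in the other.
∣-∣-complement : ∀ {x y z w} → x + y ≡ z + w → ∣ x - z ∣ ≡ ∣ y - w ∣
∣-∣-complement {x} {y} {z} {w} eq = begin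
  ∣ x - z ∣             ≡⟨ ∣m+n-m+o∣≡∣n-o∣ y x z ⟨
  ∣ y + x - y + z ∣     ≡⟨ cong₂ ∣_-_∣ (trans (+-comm y x) eq) (+-comm y z) ⟩
  ∣ z + w - z + y ∣     ≡⟨ ∣m+n-m+o∣≡∣n-o∣ z w y ⟩
  ∣ w - y ∣             ≡⟨ ∣-∣-comm w y ⟩
  ∣ y - w ∣             ∎
  where open ≡-Reasoning

↭-drop-nil : ∀ {xs ys r : List ℕ} → length ys ≡ length xs → ys ++ r ↭ xs → ys ↭ xs
↭-drop-nil {xs} {ys} {[]}    l p = subst (_↭ xs) (++-identityʳ ys) p
↭-drop-nil {xs} {ys} {z ∷ r} l p = contradiction
  (+-cancelˡ-≡ (length ys) 0 (suc (length r))
    (trans (+-identityʳ _) (trans l (trans (sym (↭-length p)) (length-++ ys)))))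
  λ ()

-- Costs and group counts for fixed pivots.

-- The pivots enter only through the map g from elements to groups, so the comparison of the
-- strategies can be made for an arbitrary bounded g.
module Groups (k : ℕ) (g : ℕ → ℕ) (g≤k : ∀ x → g x ≤ k) where

  cnt : ℕ → List ℕ → ℕ
  cnt h = sumMap (λ x → δ h (g x))

  groupCounts : List ℕ → Vec ℕ (suc k)
  groupCounts xs = tabulate (λ (h : Fin (suc k)) → length (filter (λ x → g x ≟ toℕ h) xs))

  length-filter-cnt : ∀ h xs → length (filter (λ x → g x ≟ h) xs) ≡ cnt h xs
  length-filter-cnt h [] = refl
  length-filter-cnt h (x ∷ xs) = by-cases (g x ≟ h)
    where
    by-cases : Dec (g x ≡ h) → length (filter (λ y → g y ≟ h) (x ∷ xs)) ≡ δ h (g x) + cnt h xs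
    by-cases (yes gx≡h) = trans (cong length (filter-accept (λ y → g y ≟ h) gx≡h))
      (cong₂ _+_ (sym (trans (cong (δ h) gx≡h) (δ-refl h))) (length-filter-cnt h xs))
    by-cases (no gx≢h) = trans (cong length (filter-reject (λ y → g y ≟ h) gx≢h))
      (cong₂ _+_ (sym (δ-≢ h (g x) gx≢h)) (length-filter-cnt h xs))

  cost : Tree k → List ℕ → ℕ
  cost t = sumMap (λ x → depth t (g x))

  -- Double counting: the bound on g keeps the group of each element in range, so the element is met
  -- exactly once.
  Σ<-cnt : ∀ (d : ℕ → ℕ) xs → Σ< (suc k) (λ i → d i * cnt i xs) ≡ sumMap (λ x → d (g x)) xs
  Σ<-cnt d []       = trans (Σ<-cong (suc k) λ i _ → *-zeroʳ (d i)) (trans (Σ<-const (suc k) 0) (*-zeroʳ k))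
  Σ<-cnt d (x ∷ xs) = begin
    Σ< (suc k) (λ i → d i * (δ i (g x) + cnt i xs))
      ≡⟨ Σ<-cong (suc k) (λ i _ → *-distribˡ-+ (d i) (δ i (g x)) (cnt i xs)) ⟩
    Σ< (suc k) (λ i → d i * δ i (g x) + d i * cnt i xs)
      ≡⟨ Σ<-+ (suc k) (λ i → d i * δ i (g x)) (λ i → d i * cnt i xs) ⟩
    Σ< (suc k) (λ i → d i * δ i (g x)) + Σ< (suc k) (λ i → d i * cnt i xs)
      ≡⟨ cong₂ _+_ (Σ<-δ (suc k) d (g x) (s≤s (g≤k x))) (Σ<-cnt d xs) ⟩
    d (g x) + sumMap (λ x → d (g x)) xs ∎
    where open ≡-Reasoning

  costT-groupCounts : ∀ t xs → costT t (groupCounts xs) ≡ cost t xs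
  costT-groupCounts t xs = begin
    costT t (groupCounts xs)
      ≡⟨ sum-upTo (suc k) _ ⟩
    Σ< (suc k) (λ i → depth t i * at (groupCounts xs) i)
      ≡⟨ Σ<-cong (suc k) (λ i i<n → cong (depth t i *_)
           (trans (at-tabulate (suc k) (λ h → length (filter (λ x → g x ≟ h) xs)) i i<n)
                  (length-filter-cnt i xs))) ⟩
    Σ< (suc k) (λ i → depth t i * cnt i xs)
      ≡⟨ Σ<-cnt (depth t) xs ⟩
    cost t xs ∎
    where open ≡-Reasoning

  groupCounts-↭ : ∀ {xs ys} → xs ↭ ys → groupCounts xs ≡ groupCounts ys
  groupCounts-↭ p = tabulate-cong λ h → ↭-length (filter-↭ (λ x → g x ≟ toℕ h) p)

  decAt-groupCounts : ∀ {x r xs} → x ∷ r ↭ xs → decAt (groupCounts xs) (g x) ≡ groupCounts r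
  decAt-groupCounts {x} {r} {xs} p = decAt-tabulate (suc k) _ _ (g x) λ i → begin
    length (filter (λ y → g y ≟ i) xs)              ≡⟨ length-filter-cnt i xs ⟩
    cnt i xs                                        ≡⟨ sumMap-↭ _ p ⟨
    δ i (g x) + cnt i r                             ≡⟨ cong (δ i (g x) +_) (length-filter-cnt i r) ⟨
    δ i (g x) + length (filter (λ y → g y ≟ i) r)   ∎
    where open ≡-Reasoning

  minimal : ∀ sel → Minimizing sel → ∀ t xs → cost (sel (groupCounts xs)) xs ≤ cost t xs
  minimal sel min t xs = begin
    cost (sel (groupCounts xs)) xs                 ≡⟨ costT-groupCounts (sel (groupCounts xs)) xs ⟨
    costT (sel (groupCounts xs)) (groupCounts xs)  ≤⟨ min (groupCounts xs) t ⟩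
    costT t (groupCounts xs)                       ≡⟨ costT-groupCounts t xs ⟩
    cost t xs                                      ∎
    where open ≤-Reasoning

  cost-≤ : ∀ t xs → cost t xs ≤ length xs * k
  cost-≤ t = sumMap-≤ _ (λ x → depth-≤ t (g x))

  cnt-≤ : ∀ h xs → cnt h xs ≤ length xs
  cnt-≤ h xs = ≤-trans (sumMap-≤ _ (λ x → δ-≤1 h (g x)) xs) (≤-reflexive (*-identityʳ _))

  -- The distance of a count in `ys` from its share r / m of the count in `xs`, multiplied by m to
  -- stay integral.
  dev : ℕ → ℕ → List ℕ → List ℕ → ℕ → ℕ
  dev m r ys xs h = ∣ m * cnt h ys - r * cnt h xs ∣

  -- A tree's cost is linear in the group counts with coefficients at most k, whichever tree it is.
  -- The error is therefore independent of how the tree was chosen, even if it was chosen from `ys`.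
  cost-dev : ∀ t m r ys xs → m * cost t ys ≤ r * cost t xs + k * Σ< (suc k) (dev m r ys xs)
  cost-dev t m r ys xs = begin
    m * cost t ys
      ≡⟨ cong (m *_) (Σ<-cnt (depth t) ys) ⟨
    m * Σ< (suc k) (λ i → depth t i * cnt i ys)
      ≡⟨ Σ<-* (suc k) m (λ i → depth t i * cnt i ys) ⟨
    Σ< (suc k) (λ i → m * (depth t i * cnt i ys))
      ≤⟨ Σ<-mono (suc k) term ⟩
    Σ< (suc k) (λ i → r * (depth t i * cnt i xs) + k * dev m r ys xs i)
      ≡⟨ Σ<-+ (suc k) (λ i → r * (depth t i * cnt i xs)) (λ i → k * dev m r ys xs i) ⟩
    Σ< (suc k) (λ i → r * (depth t i * cnt i xs)) + Σ< (suc k) (λ i → k * dev m r ys xs i)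
      ≡⟨ cong₂ _+_
           (trans (Σ<-* (suc k) r (λ i → depth t i * cnt i xs)) (cong (r *_) (Σ<-cnt (depth t) xs)))
           (Σ<-* (suc k) k (dev m r ys xs)) ⟩
    r * cost t xs + k * Σ< (suc k) (dev m r ys xs) ∎
    where
    open ≤-Reasoning
    swap* : ∀ a b c → a * (b * c) ≡ b * (a * c)
    swap* = solve-∀
    term : ∀ i → m * (depth t i * cnt i ys) ≤ r * (depth t i * cnt i xs) + k * dev m r ys xs i
    term i = begin
      m * (depth t i * cnt i ys)
        ≡⟨ swap* m (depth t i) _ ⟩
      depth t i * (m * cnt i ys)
        ≤⟨ *-monoʳ-≤ (depth t i) (m≤n+∣m-n∣ (m * cnt i ys) (r * cnt i xs)) ⟩
      depth t i * (r * cnt i xs + dev m r ys xs i)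
        ≡⟨ *-distribˡ-+ (depth t i) _ _ ⟩
      depth t i * (r * cnt i xs) + depth t i * dev m r ys xs i
        ≤⟨ +-mono-≤ (≤-reflexive (swap* (depth t i) r _)) (*-monoˡ-≤ _ (depth-≤ t i)) ⟩
      r * (depth t i * cnt i xs) + k * dev m r ys xs i ∎

  cost-dev′ : ∀ t m r ys xs → r * cost t xs ≤ m * cost t ys + k * Σ< (suc k) (dev m r ys xs)
  cost-dev′ t m r ys xs = ≤-trans (cost-dev t r m xs ys)
    (≤-reflexive (cong (λ s → m * cost t ys + k * s)
      (Σ<-cong (suc k) λ i _ → ∣-∣-comm (r * cnt i xs) (m * cnt i ys))))

  dev-variance : ∀ xs m v r h → length xs ≡ m → v + suc r ≡ m → 2 ≤ m →
    pick v xs (λ _ ys → dev m (suc r) ys xs h * dev m (suc r) ys xs h) ≤ falling m v * (suc r * v * cnt h xs)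
  -- Since m is at least 2, `v + r`, which is m - 1, has the form `suc m′` that `variance-≤` takes.
  dev-variance xs m v r h |xs| refl 2≤m with v + r in eq | subst (2 ≤_) (+-suc v r) 2≤m
  ... | zero   | s≤s ()
  ... | suc m′ | _ rewrite +-suc v r =
    variance-≤ (λ x → δ h (g x)) (λ x → δ-idem h (g x)) xs v r m′ (trans |xs| (cong suc eq)) eq

  -- The scale `suc w` may be the size of the remainder or the number of draws, since the variance
  -- contains the product of both and each is at most m. The adaptive strategy uses the former,
  -- sampling the latter.
  dev-sum : ∀ xs m v r q w → length xs ≡ m → v + suc r ≡ m → 2 ≤ m →
    suc r * v ≤ suc w * m → q * q ≤ suc w →
    q * pick v xs (λ _ ys → Σ< (suc k) (dev m (suc r) ys xs)) ≤ suc k * (falling m v * (suc w * m))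
  dev-sum xs m@(suc m′) v r q w |xs| v+r 2≤m rv≤wm q²≤w =
    pick-Σ<-≤ v xs (suc k) (λ h _ ys → dev m (suc r) ys xs h) q _ λ h →
      pick-deviation v xs _ q w m′ |xs|
        (≤-trans (dev-variance xs m v r h |xs| v+r 2≤m)
          (*-monoʳ-≤ (falling m v) (*-mono-≤ rv≤wm (≤-trans (cnt-≤ h xs) (≤-reflexive |xs|)))))
        q²≤w

take-length-++ : ∀ (ys zs : List ℕ) {s} → length ys ≡ s → take s (ys ++ zs) ≡ ys
take-length-++ []       zs refl = refl
take-length-++ (y ∷ ys) zs refl = cong (y ∷_) (take-length-++ ys zs refl)

drop-length-++ : ∀ (ys zs : List ℕ) {s} → length ys ≡ s → drop s (ys ++ zs) ≡ zs
drop-length-++ []       zs refl = refl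
drop-length-++ (y ∷ ys) zs refl = drop-length-++ ys zs refl

length-remainder : ∀ (zs ys : List ℕ) {xs v r} → length zs ≡ v → zs ++ ys ↭ xs → length xs ≡ v + r → length ys ≡ r
length-remainder zs ys {v = v} l p |xs| = +-cancelˡ-≡ v _ _ (trans (cong (_+ length ys) (sym l))
  (trans (sym (length-++ zs)) (trans (↭-length p) |xs|)))

-- The deviations contribute k (k + 1) for the adaptive strategy and twice that for sampling. The
-- term 2 k pays for the abandoned last steps, via q³ ≤ n, and for the sample, via q s ≤ n.
gapConstant : ℕ → ℕ
gapConstant k = 3 * k * suc k + 2 * k

-- The adaptive strategy against the best fixed tree.

module Strategies (k : ℕ) (g : ℕ → ℕ) (g≤k : ∀ x → g x ≤ k)
                  (selO : Vec ℕ (suc k) → Tree k) (minO : Minimizing selO) where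

  open Groups k g g≤k

  opt : List ℕ → ℕ
  opt xs = cost (selO (groupCounts xs)) xs

  adaptive : Vec ℕ (suc k) → List ℕ → ℕ
  adaptive rem []       = 0
  adaptive rem (x ∷ xs) = depth (selO rem) (g x) + adaptive (decAt rem (g x)) xs

  adaptiveTotal : ℕ → List ℕ → ℕ
  adaptiveTotal r xs = pick r xs (λ ys _ → adaptive (groupCounts xs) ys)

  -- Over all choices of the first element, the depths in the current tree add up to `opt xs`, each
  -- with r! continuations. The recursion closes because the decremented vector is again the count
  -- vector of what is left.
  adaptiveTotal-suc : ∀ r xs → length xs ≡ suc r →
    adaptiveTotal (suc r) xs ≡ r ! * opt xs + sumSel xs (λ _ ys → adaptiveTotal r ys)
  adaptiveTotal-suc r xs |xs| = begin
    sumSel xs (λ x ys → pick r ys (λ zs _ → d x + adaptive (decAt (groupCounts xs) (g x)) zs))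
      ≡⟨ sumSel-cong xs (λ x ys p → begin
           pick r ys (λ zs _ → d x + adaptive (decAt (groupCounts xs) (g x)) zs)
             ≡⟨ pick-+ r ys (λ _ _ → d x) (λ zs _ → adaptive (decAt (groupCounts xs) (g x)) zs) ⟩
           pick r ys (λ _ _ → d x) + pick r ys (λ zs _ → adaptive (decAt (groupCounts xs) (g x)) zs)
             ≡⟨ cong₂ _+_
                  (trans (pick-const r ys (d x)) (cong (_* d x)
                    (trans (cong (λ l → falling l r) (trans (length-rest p) (cong (_∸ 1) |xs|))) (falling-full r))))
                  (cong (λ c → pick r ys (λ zs _ → adaptive c zs)) (decAt-groupCounts p)) ⟩
           r ! * d x + adaptiveTotal r ys ∎) ⟩
    sumSel xs (λ x ys → r ! * d x + adaptiveTotal r ys)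
      ≡⟨ sumSel-+ xs (λ x _ → r ! * d x) (λ _ ys → adaptiveTotal r ys) ⟩
    sumSel xs (λ x _ → r ! * d x) + sumSel xs (λ _ ys → adaptiveTotal r ys)
      ≡⟨ cong (_+ sumSel xs (λ _ ys → adaptiveTotal r ys))
           (trans (sumSel-* xs (r !) (λ x _ → d x)) (cong (r ! *_) (sumSel-head d xs))) ⟩
    r ! * opt xs + sumSel xs (λ _ ys → adaptiveTotal r ys) ∎
    where
    open ≡-Reasoning
    d : ℕ → ℕ
    d x = depth (selO (groupCounts xs)) (g x)

  -- The current tree is a candidate for every remainder, and each element survives r of the r + 1
  -- removals.
  adaptiveTotal-≤ : ∀ r xs → length xs ≡ r → adaptiveTotal r xs ≤ r ! * opt xs
  adaptiveTotal-≤ zero    xs |xs| = z≤n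
  adaptiveTotal-≤ (suc r) xs |xs| = begin
    adaptiveTotal (suc r) xs
      ≡⟨ adaptiveTotal-suc r xs |xs| ⟩
    r ! * opt xs + sumSel xs (λ _ ys → adaptiveTotal r ys)
      ≤⟨ +-monoʳ-≤ (r ! * opt xs) (sumSel-mono xs λ x ys p → ≤-trans
           (adaptiveTotal-≤ r ys (trans (length-rest p) (cong (_∸ 1) |xs|)))
           (*-monoʳ-≤ (r !) (minimal selO minO (selO (groupCounts xs)) ys))) ⟩
    r ! * opt xs + sumSel xs (λ _ ys → r ! * cost (selO (groupCounts xs)) ys)
      ≡⟨ cong (r ! * opt xs +_) (sumSel-* xs (r !) (λ _ ys → cost (selO (groupCounts xs)) ys)) ⟩
    r ! * opt xs + r ! * sumSel xs (λ _ ys → cost (selO (groupCounts xs)) ys)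
      ≡⟨ cong (λ t → r ! * opt xs + r ! * t) (trans (sumSel-sumMap _ xs) (cong (λ l → (l ∸ 1) * opt xs) |xs|)) ⟩
    r ! * opt xs + r ! * (r * opt xs)
      ≡⟨ arith (r !) r (opt xs) ⟩
    suc r ! * opt xs ∎
    where
    open ≤-Reasoning
    arith : ∀ f r o → f * o + f * (r * o) ≡ suc r * f * o
    arith = solve-∀

  pick-adaptiveTotal : ∀ v r xs → length xs ≡ v + suc r →
    pick v xs (λ _ ys → adaptiveTotal (suc r) ys)
    ≡ r ! * pick v xs (λ _ ys → opt ys) + pick (suc v) xs (λ _ ys → adaptiveTotal r ys)
  pick-adaptiveTotal v r xs |xs| = begin
    pick v xs (λ _ ys → adaptiveTotal (suc r) ys)
      ≡⟨ pick-cong v xs (λ zs ys l p → adaptiveTotal-suc r ys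
           (length-remainder zs ys l p |xs|)) ⟩
    pick v xs (λ _ ys → r ! * opt ys + sumSel ys (λ _ zs → adaptiveTotal r zs))
      ≡⟨ pick-+ v xs (λ _ ys → r ! * opt ys) (λ _ ys → sumSel ys (λ _ zs → adaptiveTotal r zs)) ⟩
    pick v xs (λ _ ys → r ! * opt ys) + pick v xs (λ _ ys → sumSel ys (λ _ zs → adaptiveTotal r zs))
      ≡⟨ cong₂ _+_ (pick-* v xs (r !) (λ _ ys → opt ys))
           (trans (sym (pick-split v 1 xs (λ _ ys → adaptiveTotal r ys)))
                  (cong (λ w → pick w xs (λ _ ys → adaptiveTotal r ys)) (+-comm v 1))) ⟩
    r ! * pick v xs (λ _ ys → opt ys) + pick (suc v) xs (λ _ ys → adaptiveTotal r ys) ∎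
    where open ≡-Reasoning

  module _ (xs : List ℕ) (m : ℕ) (|xs| : length xs ≡ m) (2≤m : 2 ≤ m) (q : ℕ) where

    -- By exchangeability the step with r + 1 elements left costs opt(remaining) / (r + 1) on average.
    step-≥ : ∀ v r → v + suc r ≡ m → q * q ≤ suc r →
      q * (m ! * opt xs) ≤ q * m * (r ! * pick v xs (λ _ ys → opt ys)) + k * suc k * (m ! * m)
    step-≥ v r v+r q²≤r = begin
      q * (m ! * opt xs)
        ≡⟨ cong (λ t → q * (t * opt xs)) m! ⟨
      q * (N * (suc r * r !) * opt xs)
        ≡⟨ s₁ q N (suc r) (r !) (opt xs) ⟩
      q * r ! * (N * (suc r * opt xs))
        ≤⟨ *-monoʳ-≤ (q * r !) average ⟩
      q * r ! * (m * P + k * Q)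
        ≡⟨ s₂ q (r !) m P k Q ⟩
      q * m * (r ! * P) + k * r ! * (q * Q)
        ≤⟨ +-monoʳ-≤ (q * m * (r ! * P)) (*-monoʳ-≤ (k * r !)
             (dev-sum xs m v r q r |xs| v+r 2≤m (*-monoʳ-≤ (suc r) v≤m) q²≤r)) ⟩
      q * m * (r ! * P) + k * r ! * (suc k * (N * (suc r * m)))
        ≡⟨ cong (q * m * (r ! * P) +_) (s₃ k (suc k) (r !) N (suc r) m) ⟩
      q * m * (r ! * P) + k * suc k * (N * (suc r * r !) * m)
        ≡⟨ cong (λ t → q * m * (r ! * P) + k * suc k * (t * m)) m! ⟩
      q * m * (r ! * P) + k * suc k * (m ! * m) ∎
      where
      open ≤-Reasoning
      N = falling m v
      P = pick v xs (λ _ ys → opt ys)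
      Q = pick v xs (λ _ ys → Σ< (suc k) (dev m (suc r) ys xs))
      v≤m : v ≤ m
      v≤m = subst (v ≤_) v+r (m≤m+n v (suc r))
      m! : N * (suc r * r !) ≡ m !
      m! = subst (λ l → falling l v * suc r ! ≡ l !) v+r (falling-! v (suc r))
      s₁ : ∀ q N r f o → q * (N * (r * f) * o) ≡ q * f * (N * (r * o))
      s₁ = solve-∀
      s₂ : ∀ q f m P k Q → q * f * (m * P + k * Q) ≡ q * m * (f * P) + k * f * (q * Q)
      s₂ = solve-∀
      s₃ : ∀ k k′ f N r m → k * f * (k′ * (N * (r * m))) ≡ k * k′ * (N * (r * f) * m)
      s₃ = solve-∀
      -- The tree optimal for the remainder is also a candidate for all of `xs`, where it costs at
      -- least `opt xs`; the deviations carry this bound back to the remainder.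
      average : N * (suc r * opt xs) ≤ m * P + k * Q
      average = begin
        N * (suc r * opt xs)
          ≡⟨ cong (λ l → falling l v * (suc r * opt xs)) |xs| ⟨
        falling (length xs) v * (suc r * opt xs)
          ≡⟨ pick-const v xs (suc r * opt xs) ⟨
        pick v xs (λ _ _ → suc r * opt xs)
          ≤⟨ pick-mono v xs (λ _ ys _ _ → ≤-trans
               (*-monoʳ-≤ (suc r) (minimal selO minO (selO (groupCounts ys)) xs))
               (cost-dev′ (selO (groupCounts ys)) m (suc r) ys xs)) ⟩
        pick v xs (λ _ ys → m * opt ys + k * Σ< (suc k) (dev m (suc r) ys xs))
          ≡⟨ pick-+ v xs (λ _ ys → m * opt ys) (λ _ ys → k * Σ< (suc k) (dev m (suc r) ys xs)) ⟩
        pick v xs (λ _ ys → m * opt ys) + pick v xs (λ _ ys → k * Σ< (suc k) (dev m (suc r) ys xs))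
          ≡⟨ cong₂ _+_ (pick-* v xs m (λ _ ys → opt ys)) (pick-* v xs k (λ _ ys → Σ< (suc k) (dev m (suc r) ys xs))) ⟩
        m * P + k * Q ∎

    steps-≥ : ∀ r v → v + r ≡ m → r * (q * (m ! * opt xs)) ≤
      q * m * pick v xs (λ _ ys → adaptiveTotal r ys) + r * (k * suc k * (m ! * m)) + q * q * (q * (m ! * opt xs))
    steps-≥ zero    v v+r = z≤n
    steps-≥ (suc r) v v+r with ≤-total (suc r) (q * q)
    -- With at most q² elements left the remainder is too small to be proportional. The recursion
    -- stops, and the last summand alone covers all steps still due.
    ... | inj₁ r≤q² = ≤-trans (*-monoˡ-≤ (q * (m ! * opt xs)) r≤q²) (m≤n+m _ _)
    ... | inj₂ q²≤r = begin
      q * (m ! * opt xs) + r * (q * (m ! * opt xs))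
        ≤⟨ +-mono-≤ (step-≥ v r v+r q²≤r) (steps-≥ r (suc v) (trans (sym (+-suc v r)) v+r)) ⟩
      (q * m * (r ! * P) + c) + (q * m * R + r * c + q * q * (q * (m ! * opt xs)))
        ≡⟨ arith (q * m) (r ! * P) R c r (q * q * (q * (m ! * opt xs))) ⟩
      q * m * (r ! * P + R) + suc r * c + q * q * (q * (m ! * opt xs))
        ≡⟨ cong (λ t → q * m * t + suc r * c + q * q * (q * (m ! * opt xs)))
             (pick-adaptiveTotal v r xs (trans |xs| (sym v+r))) ⟨
      q * m * pick v xs (λ _ ys → adaptiveTotal (suc r) ys) + suc r * c + q * q * (q * (m ! * opt xs)) ∎
      where
      open ≤-Reasoning
      c = k * suc k * (m ! * m)
      P = pick v xs (λ _ ys → opt ys)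
      R = pick (suc v) xs (λ _ ys → adaptiveTotal r ys)
      arith : ∀ a x y c r z → (a * x + c) + (a * y + r * c + z) ≡ a * (x + y) + suc r * c + z
      arith = solve-∀

    adaptiveTotal-≥ : q * (m ! * opt xs) ≤ q * adaptiveTotal m xs + m ! * (k * suc k * m + q * q * q * k)
    adaptiveTotal-≥ = cancel 2≤m (begin
      m * (q * (m ! * opt xs))
        ≤⟨ steps-≥ m 0 refl ⟩
      q * m * W + m * (k * suc k * (m ! * m)) + q * q * (q * (m ! * opt xs))
        -- The crude bound `opt xs ≤ m * k` supplies the factor m that has to be cancelled from the
        -- last summand.
        ≤⟨ +-monoʳ-≤ (q * m * W + m * (k * suc k * (m ! * m)))
             (*-monoʳ-≤ (q * q) (*-monoʳ-≤ q (*-monoʳ-≤ (m !) opt≤mk))) ⟩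
      q * m * W + m * (k * suc k * (m ! * m)) + q * q * (q * (m ! * (m * k)))
        ≡⟨ arith q m W k (suc k) (m !) ⟩
      m * (q * W + m ! * (k * suc k * m + q * q * q * k)) ∎)
      where
      open ≤-Reasoning
      W = adaptiveTotal m xs
      opt≤mk : opt xs ≤ m * k
      opt≤mk = ≤-trans (cost-≤ (selO (groupCounts xs)) xs) (≤-reflexive (cong (_* k) |xs|))
      cancel : ∀ {m a b} → 2 ≤ m → m * a ≤ m * b → a ≤ b
      cancel {suc m} _ = *-cancelˡ-≤ (suc m)
      arith : ∀ q m W k k′ f → q * m * W + m * (k * k′ * (f * m)) + q * q * (q * (f * (m * k)))
        ≡ m * (q * W + f * (k * k′ * m + q * q * q * k))
      arith = solve-∀

  -- The sampling strategy against the best fixed tree.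

  module Sampling (t₀ : Tree k) (sel : Vec ℕ (suc k) → Tree k) (min : Minimizing sel) where

    sampled : ℕ → List ℕ → ℕ
    sampled s ys = cost t₀ (take s ys) + cost (sel (groupCounts (take s ys))) (drop s ys)

    sampledTotal : ℕ → ℕ → List ℕ → ℕ
    sampledTotal s m xs = pick m xs (λ ys _ → sampled s ys)

    cost-take-≤ : ∀ t s ys → cost t (take s ys) ≤ s * k
    cost-take-≤ t s ys = ≤-trans (cost-≤ t (take s ys))
      (*-monoˡ-≤ k (≤-trans (≤-reflexive (length-take s ys)) (m⊓n≤m s (length ys))))

    cost-take-drop : ∀ t s ys → cost t (take s ys) + cost t (drop s ys) ≡ cost t ys
    cost-take-drop t s ys = trans (sym (sumMap-++ _ (take s ys) (drop s ys)))
      (cong (cost t) (take++drop≡id s ys))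

    pick-full-const : ∀ m xs c → length xs ≡ m → pick m xs (λ _ _ → c) ≡ m ! * c
    pick-full-const m xs c |xs| = trans (pick-const m xs c)
      (cong (_* c) (trans (cong (λ l → falling l m) |xs|) (falling-full m)))

    -- Whatever tree the sample selects costs at least `opt xs` on the whole input. Only the sample
    -- is classified by another tree, and there the selected tree would cost at most s k.
    sampledTotal-≥ : ∀ s m xs → length xs ≡ m → m ! * opt xs ≤ sampledTotal s m xs + m ! * (s * k)
    sampledTotal-≥ s m xs |xs| = begin
      m ! * opt xs
        ≡⟨ pick-full-const m xs (opt xs) |xs| ⟨
      pick m xs (λ _ _ → opt xs)
        ≤⟨ pick-mono m xs (λ ys r l p → pointwise ys (↭-drop-nil (trans l (sym |xs|)) p)) ⟩
      pick m xs (λ ys _ → sampled s ys + s * k)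
        ≡⟨ pick-+ m xs (λ ys _ → sampled s ys) (λ _ _ → s * k) ⟩
      sampledTotal s m xs + pick m xs (λ _ _ → s * k)
        ≡⟨ cong (sampledTotal s m xs +_) (pick-full-const m xs (s * k) |xs|) ⟩
      sampledTotal s m xs + m ! * (s * k) ∎
      where
      open ≤-Reasoning
      pointwise : ∀ ys → ys ↭ xs → opt xs ≤ sampled s ys + s * k
      pointwise ys p = begin
        opt xs                                      ≤⟨ minimal selO minO t xs ⟩
        cost t xs                                   ≡⟨ sumMap-↭ _ p ⟨
        cost t ys                                   ≡⟨ cost-take-drop t s ys ⟨
        cost t (take s ys) + cost t (drop s ys)     ≡⟨ +-comm (cost t (take s ys)) _ ⟩
        cost t (drop s ys) + cost t (take s ys)     ≤⟨ +-mono-≤ (m≤n+m _ (cost t₀ (take s ys))) (cost-take-≤ t s ys) ⟩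
        sampled s ys + s * k                        ∎
        where t = sel (groupCounts (take s ys))

    -- The selected tree is carried from `xs` to the sample, compared there with the tree optimal
    -- for `xs`, and that one is carried back; the two transfers explain the factor 2. The
    -- deviations are then those of the remainder `zs`, for which the variance is known.
    sample-optimal : ∀ s r ys zs xs → ys ++ zs ↭ xs → let m = s + r in
      s * cost (sel (groupCounts ys)) xs ≤ s * opt xs + 2 * k * Σ< (suc k) (dev m r zs xs)
    sample-optimal s r ys zs xs p = begin
      s * cost t xs
        ≤⟨ cost-dev′ t m s ys xs ⟩
      m * cost t ys + k * Σ< (suc k) (dev m s ys xs)
        ≤⟨ +-monoˡ-≤ _ (*-monoʳ-≤ m (minimal sel min (selO (groupCounts xs)) ys)) ⟩
      m * cost (selO (groupCounts xs)) ys + k * Σ< (suc k) (dev m s ys xs)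
        ≤⟨ +-monoˡ-≤ _ (cost-dev (selO (groupCounts xs)) m s ys xs) ⟩
      s * opt xs + k * Σ< (suc k) (dev m s ys xs) + k * Σ< (suc k) (dev m s ys xs)
        ≡⟨ arith (s * opt xs) k (Σ< (suc k) (dev m s ys xs)) ⟩
      s * opt xs + 2 * k * Σ< (suc k) (dev m s ys xs)
        ≡⟨ cong (λ d → s * opt xs + 2 * k * d) (Σ<-cong (suc k) {dev m s ys xs} {dev m r zs xs} λ h _ →
             ∣-∣-complement {m * cnt h ys} {m * cnt h zs} {s * cnt h xs} {r * cnt h xs} (split h)) ⟩
      s * opt xs + 2 * k * Σ< (suc k) (dev m r zs xs) ∎
      where
      open ≤-Reasoning
      m = s + r
      t = sel (groupCounts ys)
      arith : ∀ a k d → a + k * d + k * d ≡ a + 2 * k * d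
      arith = solve-∀
      split : ∀ h → m * cnt h ys + m * cnt h zs ≡ s * cnt h xs + r * cnt h xs
      split h = trans (sym (*-distribˡ-+ m (cnt h ys) (cnt h zs)))
        (trans (cong (m *_) (trans (sym (sumMap-++ _ ys zs)) (sumMap-↭ _ p)))
               (*-distribʳ-+ (cnt h xs) s r))

    -- Charging the selected tree for all of `xs`, and s k for the sample on top, leaves a bound `h`
    -- that depends on the sample alone. The other draws then only contribute the factor `suc r !`.
    sampledTotal-≤ : ∀ s′ r q xs → let s = suc s′; m = s + suc r in
      length xs ≡ m → q * q ≤ s →
      q * sampledTotal s m xs ≤ m ! * (q * (s * k + opt xs) + 2 * k * suc k * m)
    sampledTotal-≤ s′ r q xs |xs| q²≤s = *-cancelˡ-≤ s (begin
      s * (q * sampledTotal s m xs)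
        ≤⟨ *-monoʳ-≤ s (*-monoʳ-≤ q total≤) ⟩
      s * (q * (suc r ! * H))
        ≡⟨ s₁ s q (suc r !) H ⟩
      suc r ! * (q * (s * H))
        ≤⟨ *-monoʳ-≤ (suc r !) qsH≤ ⟩
      suc r ! * (q * (N * B) + 2 * k * (suc k * (N * (s * m))))
        ≡⟨ s₂ s (suc r !) q N k (suc k) m (opt xs) ⟩
      s * (N * suc r ! * (q * (s * k + opt xs) + 2 * k * suc k * m))
        ≡⟨ cong (λ t → s * (t * (q * (s * k + opt xs) + 2 * k * suc k * m))) (falling-! s (suc r)) ⟩
      s * (m ! * (q * (s * k + opt xs) + 2 * k * suc k * m)) ∎)
      where
      open ≤-Reasoning
      s = suc s′
      m = s + suc r
      N = falling m s
      h : List ℕ → ℕ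
      h ys = s * k + cost (sel (groupCounts ys)) xs
      H = pick s xs (λ ys _ → h ys)
      B = s * (s * k + opt xs)
      Q = pick s xs (λ _ zs → Σ< (suc k) (dev m (suc r) zs xs))
      2≤m : 2 ≤ m
      2≤m = s≤s (≤-trans (s≤s z≤n) (m≤n+m (suc r) s′))
      s₁ : ∀ s q f H → s * (q * (f * H)) ≡ f * (q * (s * H))
      s₁ = solve-∀
      s₂ : ∀ s f q N k k′ m o → f * (q * (N * (s * (s * k + o))) + 2 * k * (k′ * (N * (s * m))))
        ≡ s * (N * f * (q * (s * k + o) + 2 * k * k′ * m))
      s₂ = solve-∀
      s₃ : ∀ q k Q → q * (2 * k * Q) ≡ 2 * k * (q * Q)
      s₃ = solve-∀
      s₄ : ∀ s a o d → s * a + (s * o + d) ≡ s * (a + o) + d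
      s₄ = solve-∀

      pointwise : ∀ ys → ys ↭ xs → sampled s ys ≤ h (take s ys)
      pointwise ys p = +-mono-≤ (cost-take-≤ t₀ s ys)
        (≤-trans (m≤n+m _ (cost t (take s ys)))
          (≤-reflexive (trans (cost-take-drop t s ys) (sumMap-↭ _ p))))
        where t = sel (groupCounts (take s ys))

      total≤ : sampledTotal s m xs ≤ suc r ! * H
      total≤ = begin
        pick m xs (λ ys _ → sampled s ys)
          ≤⟨ pick-mono m xs (λ ys _ l p → pointwise ys (↭-drop-nil (trans l (sym |xs|)) p)) ⟩
        pick (s + suc r) xs (λ ys _ → h (take s ys))
          ≡⟨ pick-split s (suc r) xs (λ ys _ → h (take s ys)) ⟩
        pick s xs (λ ys zs → pick (suc r) zs (λ us _ → h (take s (ys ++ us))))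
          ≡⟨ pick-cong s xs (λ ys zs l p → trans
               (pick-cong (suc r) zs λ us _ _ _ → cong h (take-length-++ ys us l))
               (pick-full-const (suc r) zs (h ys) (length-remainder ys zs l p |xs|))) ⟩
        pick s xs (λ ys _ → suc r ! * h ys)
          ≡⟨ pick-* s xs (suc r !) (λ ys _ → h ys) ⟩
        suc r ! * H ∎

      qsH≤ : q * (s * H) ≤ q * (N * B) + 2 * k * (suc k * (N * (s * m)))
      qsH≤ = begin
        q * (s * H)
          ≡⟨ cong (q *_) (pick-* s xs s (λ ys _ → h ys)) ⟨
        q * pick s xs (λ ys _ → s * h ys)
          ≤⟨ *-monoʳ-≤ q (pick-mono s xs λ ys zs _ p → begin
               s * (s * k + cost (sel (groupCounts ys)) xs)
                 ≡⟨ *-distribˡ-+ s (s * k) _ ⟩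
               s * (s * k) + s * cost (sel (groupCounts ys)) xs
                 ≤⟨ +-monoʳ-≤ (s * (s * k)) (sample-optimal s (suc r) ys zs xs p) ⟩
               s * (s * k) + (s * opt xs + 2 * k * Σ< (suc k) (dev m (suc r) zs xs))
                 ≡⟨ s₄ s (s * k) (opt xs) (2 * k * Σ< (suc k) (dev m (suc r) zs xs)) ⟩
               B + 2 * k * Σ< (suc k) (dev m (suc r) zs xs) ∎) ⟩
        q * pick s xs (λ _ zs → B + 2 * k * Σ< (suc k) (dev m (suc r) zs xs))
          ≡⟨ cong (q *_) (trans (pick-+ s xs (λ _ _ → B) (λ _ zs → 2 * k * Σ< (suc k) (dev m (suc r) zs xs)))
               (cong₂ _+_ (trans (pick-const s xs B) (cong (λ l → falling l s * B) |xs|))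
                          (pick-* s xs (2 * k) (λ _ zs → Σ< (suc k) (dev m (suc r) zs xs))))) ⟩
        q * (N * B + 2 * k * Q)
          ≡⟨ trans (*-distribˡ-+ q (N * B) (2 * k * Q)) (cong (q * (N * B) +_) (s₃ q k Q)) ⟩
        q * (N * B) + 2 * k * (q * Q)
          ≤⟨ +-monoʳ-≤ (q * (N * B)) (*-monoʳ-≤ (2 * k)
               (dev-sum xs m s r q s′ |xs| refl 2≤m
                 (≤-trans (≤-reflexive (*-comm (suc r) s)) (*-monoʳ-≤ s (m≤n+m (suc r) s))) q²≤s)) ⟩
        q * (N * B) + 2 * k * (suc k * (N * (s * m))) ∎

    -- Only the second inequality needs the deviation bounds, those of both strategies; the first
    -- one pays just for the sample.
    strategies-close : ∀ s′ r q n xs → let s = suc s′; m = s + suc r in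
      length xs ≡ m → m ≤ n → q * q ≤ s → q * s ≤ n → q * q * q ≤ n →
      (q * adaptiveTotal m xs ≤ q * sampledTotal s m xs + m ! * (gapConstant k * n)) ×
      (q * sampledTotal s m xs ≤ q * adaptiveTotal m xs + m ! * (gapConstant k * n))
    strategies-close s′ r q n xs |xs| m≤n q²≤s qs≤n q³≤n = below , above
      where
      open ≤-Reasoning
      s = suc s′
      m = s + suc r
      C = gapConstant k
      O = adaptiveTotal m xs
      SP = sampledTotal s m xs
      2≤m : 2 ≤ m
      2≤m = s≤s (≤-trans (s≤s z≤n) (m≤n+m (suc r) s′))
      s₁ : ∀ q x f s k → q * (x + f * (s * k)) ≡ q * x + f * (q * s * k)
      s₁ = solve-∀
      s₂ : ∀ n k k′ → n * k + (3 * k * k′ * n + k * n) ≡ (3 * k * k′ + 2 * k) * n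
      s₂ = solve-∀
      s₃ : ∀ f q s k o k′ m → f * (q * (s * k + o) + 2 * k * k′ * m) ≡ q * (f * o) + f * (q * s * k + 2 * k * k′ * m)
      s₃ = solve-∀
      s₄ : ∀ a f m qs c₃ k k′ → a + f * (k * k′ * m + c₃ * k) + f * (qs * k + 2 * k * k′ * m)
        ≡ a + f * (3 * k * k′ * m + c₃ * k + qs * k)
      s₄ = solve-∀
      s₅ : ∀ k k′ n → 3 * k * k′ * n + n * k + n * k ≡ (3 * k * k′ + 2 * k) * n
      s₅ = solve-∀
      below : q * O ≤ q * SP + m ! * (C * n)
      below = begin
        q * O                              ≤⟨ *-monoʳ-≤ q (≤-trans (adaptiveTotal-≤ m xs |xs|) (sampledTotal-≥ s m xs |xs|)) ⟩
        q * (SP + m ! * (s * k))           ≡⟨ s₁ q SP (m !) s k ⟩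
        q * SP + m ! * (q * s * k)         ≤⟨ +-monoʳ-≤ (q * SP) (*-monoʳ-≤ (m !) (≤-trans (*-monoˡ-≤ k qs≤n)
                                                (≤-trans (m≤m+n (n * k) (3 * k * suc k * n + k * n)) (≤-reflexive (s₂ n k (suc k)))))) ⟩
        q * SP + m ! * (C * n)             ∎
      above : q * SP ≤ q * O + m ! * (C * n)
      above = begin
        q * SP
          ≤⟨ sampledTotal-≤ s′ r q xs |xs| q²≤s ⟩
        m ! * (q * (s * k + opt xs) + 2 * k * suc k * m)
          ≡⟨ s₃ (m !) q s k (opt xs) (suc k) m ⟩
        q * (m ! * opt xs) + m ! * (q * s * k + 2 * k * suc k * m)
          ≤⟨ +-monoˡ-≤ _ (adaptiveTotal-≥ xs m |xs| 2≤m q) ⟩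
        q * O + m ! * (k * suc k * m + q * q * q * k) + m ! * (q * s * k + 2 * k * suc k * m)
          ≡⟨ s₄ (q * O) (m !) m (q * s) (q * q * q) k (suc k) ⟩
        q * O + m ! * (3 * k * suc k * m + q * q * q * k + q * s * k)
          ≤⟨ +-monoʳ-≤ (q * O) (*-monoʳ-≤ (m !) (+-mono-≤ (+-mono-≤
               (*-monoʳ-≤ (3 * k * suc k) m≤n) (*-monoˡ-≤ k q³≤n)) (*-monoˡ-≤ k qs≤n))) ⟩
        q * O + m ! * (3 * k * suc k * n + n * k + n * k)
          ≡⟨ cong (λ t → q * O + m ! * t) (s₅ k (suc k) n) ⟩
        q * O + m ! * (C * n) ∎

-- The sample size and the integer fourth root.

module _ {P : ℕ → Set} (P? : ∀ m → Dec (P m)) where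

  count-≤ : ∀ b n (f : ℕ → ℕ) → (∀ i → P (f i) → i < b) → length (filter P? (applyUpTo f n)) ≤ b
  count-≤ b zero    f bound = z≤n
  count-≤ b (suc n) f bound with P? (f 0)
  count-≤ b (suc n) f bound | no _ =
    count-≤ b n (f ∘ suc) λ i p → ≤-trans (n≤1+n (suc i)) (bound (suc i) p)
  count-≤ zero    (suc n) f bound | yes p = contradiction (bound 0 p) λ ()
  count-≤ (suc b) (suc n) f bound | yes p = s≤s (count-≤ b n (f ∘ suc) λ i p′ → ≤-pred (bound (suc i) p′))

  count-≥ : ∀ b n (f : ℕ → ℕ) → b ≤ n → (∀ i → i < b → P (f i)) → b ≤ length (filter P? (applyUpTo f n))
  count-≥ zero    n       f b≤n       holds = z≤n
  count-≥ (suc b) (suc n) f (s≤s b≤n) holds with P? (f 0)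
  ... | yes _ = s≤s (count-≥ b n (f ∘ suc) b≤n λ i i<b → holds (suc i) (s≤s i<b))
  ... | no ¬p = contradiction (holds 0 (s≤s z≤n)) ¬p

^4-distrib-* : ∀ x y → (x * y) ^ 4 ≡ x ^ 4 * y ^ 4
^4-distrib-* x y = arith x y
  where
  arith : ∀ x y → x * y * (x * y * (x * y * (x * y * 1))) ≡ x * (x * (x * (x * 1))) * (y * (y * (y * (y * 1))))
  arith = solve-∀

^4-cancel-≤ : ∀ {x y} → x ^ 4 ≤ y ^ 4 → x ≤ y
^4-cancel-≤ {x} {y} le with x ≤? y
... | yes x≤y = x≤y
... | no x≰y  = contradiction (^-monoˡ-< 4 (≰⇒> x≰y)) (≤⇒≯ le)

fourthRoot : ∀ n → Σ ℕ λ q → q ^ 4 ≤ n × n < suc q ^ 4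
fourthRoot zero = 0 , z≤n , s≤s z≤n
fourthRoot (suc n) with fourthRoot n
... | q , q⁴≤n , n<q⁴ with suc q ^ 4 ≤? suc n
-- A step from n to n + 1 raises the root by at most one, so the upper bound holds again for the new
-- root.
...   | yes le = suc q , le , <-≤-trans (s≤s n<q⁴) (^-monoˡ-< 4 (n<1+n (suc q)))
...   | no nle = q , m≤n⇒m≤1+n q⁴≤n , ≰⇒> nle

module _ (n q : ℕ) (q⁴≤n : q ^ 4 ≤ n) (1≤q : 1 ≤ q) where

  private instance
    q≢0 : NonZero q
    q≢0 = >-nonZero 1≤q

  q³≤n : q * q * q ≤ n
  q³≤n = ≤-trans (≤-trans (m≤m*n (q * q * q) q) (≤-reflexive (arith q))) q⁴≤n
    where
    arith : ∀ q → q * q * q * q ≡ q * (q * (q * (q * 1)))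
    arith = solve-∀

  -- If m⁴ ≤ n³, then (m q)⁴ ≤ n³ q⁴ ≤ n⁴, so every counted m is at most n / q.
  q*sampleSize≤n : q * sampleSize n ≤ n
  q*sampleSize≤n = begin
    q * sampleSize n ≤⟨ *-monoʳ-≤ q (count-≤ (λ m → m ^ 4 ≤? n ^ 3) (n / q) n suc bound) ⟩
    q * (n / q)      ≡⟨ *-comm q (n / q) ⟩
    n / q * q        ≤⟨ m/n*n≤m n q ⟩
    n                ∎
    where
    open ≤-Reasoning
    bound : ∀ i → suc i ^ 4 ≤ n ^ 3 → suc i ≤ n / q
    bound i h = begin
      suc i           ≡⟨ m*n/n≡m (suc i) q ⟨
      suc i * q / q   ≤⟨ /-monoˡ-≤ q (^4-cancel-≤ (begin
        (suc i * q) ^ 4      ≡⟨ ^4-distrib-* (suc i) q ⟩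
        suc i ^ 4 * q ^ 4    ≤⟨ *-mono-≤ h q⁴≤n ⟩
        n ^ 3 * n            ≡⟨ *-comm (n ^ 3) n ⟩
        n ^ 4                ∎)) ⟩
      n / q           ∎

  -- Every m up to q² is counted, since m⁴ ≤ q⁸ ≤ n² ≤ n³.
  q²≤sampleSize : q * q ≤ sampleSize n
  q²≤sampleSize = count-≥ (λ m → m ^ 4 ≤? n ^ 3) (q * q) n suc
    (≤-trans (m≤m*n (q * q) q) q³≤n) λ i i<q² → begin
      suc i ^ 4        ≤⟨ ^-monoˡ-≤ 4 i<q² ⟩
      (q * q) ^ 4      ≡⟨ ^4-distrib-* q q ⟩
      q ^ 4 * q ^ 4    ≤⟨ *-mono-≤ q⁴≤n q⁴≤n ⟩
      n * n            ≡⟨ cong (n *_) (*-identityʳ n) ⟨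
      n ^ 2            ≤⟨ ^-monoʳ-≤ n {{>-nonZero (≤-trans (*-mono-≤ (*-mono-≤ 1≤q 1≤q) 1≤q) q³≤n)}} (n≤1+n 2) ⟩
      n ^ 3            ∎
    where open ≤-Reasoning

-- From fixed pivots to the average over all inputs.

grp-≤ : ∀ k e x → grp k e x ≤ k
grp-≤ k e x = ≤-trans (length-filter (_<? x) (take k e))
  (≤-trans (≤-reflexive (length-take k e)) (m⊓n≤m k (length e)))

module _ (k : ℕ) (t₀ : Tree k) (selO selSP : Vec ℕ (suc k) → Tree k)
         (minO : Minimizing selO) (minSP : Minimizing selSP) where

  private
    module G (piv : List ℕ) = Groups k (grp k piv) (grp-≤ k piv)
    module S (piv : List ℕ) = Strategies k (grp k piv) (grp-≤ k piv) selO minO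
    module Sa (piv : List ℕ) = S.Sampling piv t₀ selSP minSP

    -- Taking the pivot list itself as argument lets `take k e` be replaced by congruence.
    groupsBelow : List ℕ → List ℕ → Vec ℕ (suc k)
    groupsBelow l xs = tabulate (λ (h : Fin (suc k)) →
      length (filter (λ x → length (filter (_<? x) l) ≟ toℕ h) xs))

  take-pivots : ∀ piv ys → length piv ≡ k → take k (piv ++ ys) ≡ take k piv
  take-pivots piv ys l = trans (take-length-++ piv ys l)
    (sym (trans (cong (take k) (sym (++-identityʳ piv))) (take-length-++ piv [] l)))

  goO-adaptive : ∀ e piv → take k e ≡ take k piv → ∀ rem xs →
    goO k e selO rem xs ≡ S.adaptive piv rem xs
  goO-adaptive e piv eq rem []       = refl
  goO-adaptive e piv eq rem (x ∷ xs)
    rewrite cong (λ l → length (filter (_<? x) l)) eq =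
    cong (depth (selO rem) (grp k piv x) +_) (goO-adaptive e piv eq _ xs)

  costO-adaptive : ∀ piv ys → length piv ≡ k →
    costO k selO (piv ++ ys) ≡ S.adaptive piv (G.groupCounts piv ys) ys
  costO-adaptive piv ys l = begin
    goO k e selO (groupsBelow (take k e) (drop k e)) (drop k e)
      ≡⟨ cong (λ zs → goO k e selO (groupsBelow (take k e) zs) zs) (drop-length-++ piv ys l) ⟩
    goO k e selO (groupsBelow (take k e) ys) ys
      ≡⟨ cong (λ us → goO k e selO (groupsBelow us ys) ys) (take-pivots piv ys l) ⟩
    goO k e selO (G.groupCounts piv ys) ys
      ≡⟨ goO-adaptive e piv (take-pivots piv ys l) _ ys ⟩
    S.adaptive piv (G.groupCounts piv ys) ys ∎
    where
    open ≡-Reasoning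
    e = piv ++ ys

  costSP-sampled : ∀ n piv ys → length piv ≡ k →
    costSP k t₀ selSP n (piv ++ ys) ≡ Sa.sampled piv (sampleSize n) ys
  costSP-sampled n piv ys l = cong₂
    (λ us zs → sum (map (λ x → depth t₀ (length (filter (_<? x) us))) (take s zs))
      + sum (map (λ x → depth (selSP (groupsBelow us (take s zs))) (length (filter (_<? x) us))) (drop s zs)))
    (take-pivots piv ys l) (drop-length-++ piv ys l)
    where s = sampleSize n

  sum-perms-pivots : ∀ m F → sum (map F (perms (k + m)))
    ≡ pick k (descending (k + m)) (λ piv xs → pick m xs (λ ys _ → F (piv ++ ys)))
  sum-perms-pivots m F = trans (sum-perms (k + m) F) (pick-split k m (descending (k + m)) (λ ys _ → F ys))

  totalO-pick : ∀ m → totalO k selO (k + m)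
    ≡ pick k (descending (k + m)) (λ piv xs → S.adaptiveTotal piv m xs)
  totalO-pick m = trans (sum-perms-pivots m _) (pick-cong k (descending (k + m)) λ piv xs l p →
    pick-cong m xs λ ys r l′ p′ → trans (costO-adaptive piv ys l)
      -- The strategy counts groups in the drawn order `ys`, while `adaptiveTotal` counts in the
      -- undrawn list `xs`; counts do not see the order.
      (cong (λ c → S.adaptive piv c ys) (G.groupCounts-↭ piv {ys} {xs} (↭-drop-nil
        (trans l′ (sym (length-remainder piv xs l p (length-descending (k + m))))) p′))))

  totalSP-pick : ∀ m → totalSP k t₀ selSP (k + m)
    ≡ pick k (descending (k + m)) (λ piv xs → Sa.sampledTotal piv (sampleSize (k + m)) m xs)
  totalSP-pick m = trans (sum-perms-pivots m _) (pick-cong k (descending (k + m)) λ piv xs l p →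
    pick-cong m xs λ ys _ _ _ → costSP-sampled (k + m) piv ys l)

  -- The m! orders of the remaining elements, times the number of pivot drawings, give (k + m)!.
  pick-pivots-≤ : ∀ m q c (F G : List ℕ → List ℕ → ℕ) → let L = descending (k + m) in
    (∀ piv xs → length xs ≡ m → q * F piv xs ≤ q * G piv xs + m ! * c) →
    q * pick k L F ≤ q * pick k L G + (k + m) ! * c
  pick-pivots-≤ m q c F G F≤G = begin
    q * pick k L F
      ≡⟨ pick-* k L q F ⟨
    pick k L (λ piv xs → q * F piv xs)
      ≤⟨ pick-mono k L (λ piv xs l p → F≤G piv xs (length-remainder piv xs l p (length-descending (k + m)))) ⟩
    pick k L (λ piv xs → q * G piv xs + m ! * c)
      ≡⟨ pick-+ k L (λ piv xs → q * G piv xs) (λ _ _ → m ! * c) ⟩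
    pick k L (λ piv xs → q * G piv xs) + pick k L (λ _ _ → m ! * c)
      ≡⟨ cong₂ _+_ (pick-* k L q G) (trans (pick-const k L (m ! * c))
           (trans (cong (λ l → falling l k * (m ! * c)) (length-descending (k + m)))
           (trans (sym (*-assoc (falling (k + m) k) (m !) c)) (cong (_* c) (falling-! k m))))) ⟩
    q * pick k L G + (k + m) ! * c ∎
    where
    open ≤-Reasoning
    L = descending (k + m)

  totals-close : ∀ m s′ r q → let n = k + m; s = sampleSize n in
    s ≡ suc s′ → m ≡ suc s′ + suc r → q * q ≤ s → q * s ≤ n → q * q * q ≤ n →
    q * ∣ totalSP k t₀ selSP n - totalO k selO n ∣ ≤ n ! * (gapConstant k * n)
  totals-close m s′ r q s≡ refl q²≤s qs≤n q³≤n
    rewrite totalSP-pick m | totalO-pick m | s≡ = begin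
    q * ∣ SP - O ∣     ≡⟨ *-distribˡ-∣-∣ q SP O ⟩
    ∣ q * SP - q * O ∣ ≤⟨ close (pick-pivots-≤ m q _ _ _ λ piv xs l → proj₂ (bounds piv xs l))
                                (pick-pivots-≤ m q _ _ _ λ piv xs l → proj₁ (bounds piv xs l)) ⟩
    (k + m) ! * (gapConstant k * (k + m)) ∎
    where
    open ≤-Reasoning
    n = k + m
    O = pick k (descending n) (λ piv xs → S.adaptiveTotal piv m xs)
    SP = pick k (descending n) (λ piv xs → Sa.sampledTotal piv (suc s′) m xs)
    bounds = λ piv xs |xs| → Sa.strategies-close piv s′ r q n xs |xs| (m≤n+m m k) q²≤s qs≤n q³≤n
    close : ∀ {x y c} → x ≤ y + c → y ≤ x + c → ∣ x - y ∣ ≤ c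
    close {x} {y} {c} x≤ y≤ with ≤-total x y
    ... | inj₁ x≤y = ≤-trans (≤-reflexive (m≤n⇒∣m-n∣≡n∸m x≤y)) (m≤n+o⇒m∸n≤o y x y≤)
    ... | inj₂ y≤x = ≤-trans (≤-reflexive (trans (∣-∣-comm x y) (m≤n⇒∣m-n∣≡n∸m y≤x))) (m≤n+o⇒m∸n≤o x y x≤)

-- The final bound in fourth powers.

-- One of the four factors n is traded for (2 q)⁴, as n < (q + 1)⁴ ≤ (2 q)⁴, and q⁴ cancels.
-- Rounding the root thus costs a factor 2 in the constant.
fourth-power-bound : ∀ q Δ f C n → 1 ≤ q → n < suc q ^ 4 → q * Δ ≤ f * (C * n) →
  Δ ^ 4 ≤ (2 * C) ^ 4 * f ^ 4 * n ^ 3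
fourth-power-bound q@(suc _) Δ f C n 1≤q n<q⁴ bound = *-cancelˡ-≤ (q ^ 4) {{m^n≢0 q 4}} (begin
  q ^ 4 * Δ ^ 4                              ≡⟨ ^4-distrib-* q Δ ⟨
  (q * Δ) ^ 4                                ≤⟨ ^-monoˡ-≤ 4 bound ⟩
  (f * (C * n)) ^ 4                          ≡⟨ trans (^4-distrib-* f (C * n)) (cong (f ^ 4 *_) (^4-distrib-* C n)) ⟩
  f ^ 4 * (C ^ 4 * (n * n ^ 3))              ≤⟨ *-monoʳ-≤ (f ^ 4) (*-monoʳ-≤ (C ^ 4) (*-monoˡ-≤ (n ^ 3) n≤)) ⟩
  f ^ 4 * (C ^ 4 * ((2 * q) ^ 4 * n ^ 3))    ≡⟨ cong (λ t → f ^ 4 * (C ^ 4 * (t * n ^ 3))) (^4-distrib-* 2 q) ⟩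
  f ^ 4 * (C ^ 4 * (16 * q ^ 4 * n ^ 3))     ≡⟨ rearrange (q ^ 4) (f ^ 4) (C ^ 4) (n ^ 3) ⟩
  q ^ 4 * (16 * C ^ 4 * f ^ 4 * n ^ 3)       ≡⟨ cong (λ t → q ^ 4 * (t * f ^ 4 * n ^ 3)) (^4-distrib-* 2 C) ⟨
  q ^ 4 * ((2 * C) ^ 4 * f ^ 4 * n ^ 3)      ∎)
  where
  open ≤-Reasoning
  n≤ : n ≤ (2 * q) ^ 4
  n≤ = ≤-trans (<⇒≤ n<q⁴) (^-monoˡ-≤ 4 (≤-trans (+-monoˡ-≤ q 1≤q) (≤-reflexive (cong (q +_) (sym (+-identityʳ q))))))
  rearrange : ∀ q f C n → f * (C * (16 * q * n)) ≡ q * (16 * C * f * n)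
  rearrange = solve-∀

-- The sample takes at most half of n, and k + 1 at most the other half, so an element is left to
-- classify after sampling.
sample-<-rest : ∀ k m q s → 2 ≤ q → q * s ≤ k + m → 2 + 2 * k ≤ k + m → suc s ≤ m
sample-<-rest k m q s 2≤q qs≤n k≤n = +-cancelˡ-≤ k (suc s) m (*-cancelˡ-≤ 2 (begin
  2 * (k + suc s)           ≡⟨ s₁ k s ⟩
  2 * s + (2 + 2 * k)       ≤⟨ +-mono-≤ (≤-trans (*-monoˡ-≤ s 2≤q) qs≤n) k≤n ⟩
  (k + m) + (k + m)         ≡⟨ cong ((k + m) +_) (+-identityʳ (k + m)) ⟨
  2 * (k + m)               ∎))
  where
  open ≤-Reasoning
  s₁ : ∀ k s → 2 * (k + suc s) ≡ 2 * s + (2 + 2 * k)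
  s₁ = solve-∀

theorem5p4 : (k : ℕ) → 1 ≤ k → (t0 : Tree k) →
    (selO selSP : Vec ℕ (suc k) → Tree k) → Minimizing selO → Minimizing selSP →
    Σ ℕ λ d → 1 ≤ d × Σ ℕ λ C → Σ ℕ λ N → ∀ n → N ≤ n → k < n →
    ∣ totalSP k t0 selSP n - totalO k selO n ∣ ^ d ≤ C ^ d * (n !) ^ d * n ^ (d ∸ 1)
theorem5p4 k _ t0 selO selSP minO minSP =
  -- Exponent 4 means ε = 1/4. In the threshold, 16 forces q ≥ 2, and 2 + 2 k leaves room for the
  -- pivots and one element beyond the sample.
  4 , s≤s z≤n , 2 * gapConstant k , 16 + (2 + 2 * k) , bound
  where
  C = gapConstant k
  bound : ∀ n → 16 + (2 + 2 * k) ≤ n → k < n →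
    ∣ totalSP k t0 selSP n - totalO k selO n ∣ ^ 4 ≤ (2 * C) ^ 4 * (n !) ^ 4 * n ^ 3
  bound n N≤n k<n with m≤n⇒∃[o]m+o≡n (<⇒≤ k<n)
  ... | m , refl with fourthRoot (k + m)
  ...   | q , q⁴≤n , n<q⁴ = fourth-power-bound q _ (n !) C n 1≤q n<q⁴ close
    where
    s = sampleSize n
    2≤q : 2 ≤ q
    2≤q = ≮⇒≥ λ q<2 → <⇒≱ n<q⁴ (≤-trans (^-monoˡ-≤ 4 q<2) (≤-trans (m≤m+n 16 (2 + 2 * k)) N≤n))
    1≤q : 1 ≤ q
    1≤q = ≤-trans (n≤1+n 1) 2≤q
    q²≤s : q * q ≤ s
    q²≤s = q²≤sampleSize n q q⁴≤n 1≤q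
    qs≤n : q * s ≤ n
    qs≤n = q*sampleSize≤n n q q⁴≤n 1≤q
    close : q * ∣ totalSP k t0 selSP n - totalO k selO n ∣ ≤ n ! * (C * n)
    close with m≤n⇒∃[o]m+o≡n (≤-trans (*-mono-≤ 1≤q 1≤q) q²≤s)
             | m≤n⇒∃[o]m+o≡n (sample-<-rest k m q s 2≤q qs≤n (≤-trans (m≤n+m _ 16) N≤n))
    ... | s′ , s≡ | r , m≡ = totals-close k t0 selO selSP minO minSP m s′ r q (sym s≡)
      (trans (sym m≡) (trans (sym (+-suc s r)) (cong (_+ suc r) (sym s≡))))
      q²≤s qs≤n (q³≤n n q q⁴≤n 1≤q)
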